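{- Let $v\ge 2$. Suppose $M=M_1+M_2$, where $M$ is the incidence matrix of a symmetric $(v,k,\lambda)$ design and $M_i$ is the incidence matrix of a symmetric $(v,k_i,\lambda_i)$ design ($i=1,2$). Let $\sigma=(k_1-\lambda_1)(k_2-\lambda_2)-\frac{2k_1k_2}{v-1}+1$. If $v$ is even, then $\sigma$ is the square of an integer. If $v$ is odd and $\sigma\neq 0$, then \[(\sigma,\sigma)_p^{\binom{v-1}{2}}(\sigma,v)_p=\big(\sigma,(-1)^{(v-1)/2}v\big)_p=1\] for every odd prime $p$.
   Context: A symmetric $(v,k,\lambda)$ design has as incidence matrix a $v\times v$ matrix $M$ with entries in $\{0,1\}$, every row and every column containing exactly $k$ ones, such that $MM^{\top}=M^{\top}M=(k-\lambda)I_v+\lambda J_v$, where $I_v$ is the identity and $J_v$ the all-ones $v\times v$ matrix. For nonzero rationals $a,b$ and a prime $p$, the Hilbert symbol $(a,b)_p$ is $1$ if $ax^2+by^2=z^2$ has a solution $(x,y,z)\neq(0,0,0)$ in the $p$-adic numbers $\mathbb{Q}_p$, and $-1$ otherwise. -}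

module Defs where

open import Data.Nat as ℕ using (ℕ; zero; suc; _≤_)
open import Data.Nat.Properties using (≤-trans)
open import Data.Integer as ℤ using (ℤ; +_)
open import Data.Integer.Divisibility using (_∣_)
open import Data.Rational as ℚ using (ℚ; ↥_; ↧_)
open import Data.Fin as Fin using (Fin; zero; suc)
open import Data.Product using (Σ; ∃; _×_; _,_)
open import Data.Sum using (_⊎_)
open import Relation.Binary.PropositionalEquality using (_≡_; _≢_)
open import Relation.Nullary using (¬_; yes; no)

sumFin : ∀ {n} → (Fin n → ℤ) → ℤ
sumFin {zero}  f = + 0
sumFin {suc n} f = f zero ℤ.+ sumFin (λ i → f (suc i))

Matrix : ℕ → Set
Matrix v = Fin v → Fin v → ℤ

transpose : ∀ {v} → Matrix v → Matrix v
transpose M i j = M j i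

_·_ : ∀ {v} → Matrix v → Matrix v → Matrix v
(A · B) i j = sumFin (λ l → A i l ℤ.* B l j)

I : ∀ {v} → Matrix v
I i j with i Fin.≟ j
... | yes _ = + 1
... | no _  = + 0

J : ∀ {v} → Matrix v
J i j = + 1

designGram : ∀ {v} → ℤ → ℤ → Matrix v
designGram k l i j = (k ℤ.- l) ℤ.* I i j ℤ.+ l ℤ.* J i j

record IsSymmetricDesign (v k l : ℕ) (M : Matrix v) : Set where
  field
    zero-one : ∀ i j → M i j ≡ + 0 ⊎ M i j ≡ + 1
    row-sum  : ∀ i → sumFin (λ j → M i j) ≡ + k
    col-sum  : ∀ j → sumFin (λ i → M i j) ≡ + k
    MMᵀ      : ∀ i j → (M · transpose M) i j ≡ designGram (+ k) (+ l) i j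
    MᵀM      : ∀ i j → (transpose M · M) i j ≡ designGram (+ k) (+ l) i j

nonZero-pred : ∀ {v} → 2 ≤ v → ℕ.NonZero (v ℕ.∸ 1)
nonZero-pred (ℕ.s≤s (ℕ.s≤s _)) = _

sigma : (v k₁ l₁ k₂ l₂ : ℕ) → 2 ≤ v → ℚ
sigma v k₁ l₁ k₂ l₂ v≥2 =
  ((((+ k₁) ℤ.- (+ l₁)) ℤ.* ((+ k₂) ℤ.- (+ l₂))) ℚ./ 1)
    ℚ.- ((+ (2 ℕ.* k₁ ℕ.* k₂)) ℚ./ (v ℕ.∸ 1)) {{nonZero-pred v≥2}}
    ℚ.+ ℚ.1ℚ

-- p-adic integers, as compatible sequences x n with x (n+1) ≡ x n (mod pⁿ);
-- x n represents the residue of the p-adic integer modulo pⁿ.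

record ℤₚ (p : ℕ) : Set where
  field
    res    : ℕ → ℤ
    compat : ∀ n → (+ (p ℕ.^ n)) ∣ (res (suc n) ℤ.- res n)
open ℤₚ public

NonZeroₚ : ∀ {p} → ℤₚ p → Set
NonZeroₚ {p} x = ∃ λ n → ¬ ((+ (p ℕ.^ n)) ∣ res x n)

SolvesₚEq : ∀ {p} → ℤ → ℤ → ℤ → ℤₚ p → ℤₚ p → ℤₚ p → Set
SolvesₚEq {p} A B C x y z =
  ∀ n → (+ (p ℕ.^ n)) ∣
        (A ℤ.* (res x n ℤ.* res x n) ℤ.+ B ℤ.* (res y n ℤ.* res y n)
           ℤ.- C ℤ.* (res z n ℤ.* res z n))

-- a x² + b y² = z² has a nontrivial solution in ℚ_p.
-- Writing a = a₁/a₂, b = b₁/b₂ and clearing denominators, this is the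
-- homogeneous equation a₁b₂ x² + b₁a₂ y² = a₂b₂ z², and (by homogeneity,
-- scaling by a power of p) a nontrivial ℚ_p-solution exists iff a
-- nontrivial ℤ_p-solution exists.
HilbertSolvable : (p : ℕ) → ℚ → ℚ → Set
HilbertSolvable p a b =
  Σ (ℤₚ p) λ x → Σ (ℤₚ p) λ y → Σ (ℤₚ p) λ z →
    (NonZeroₚ x ⊎ NonZeroₚ y ⊎ NonZeroₚ z) ×
    SolvesₚEq ((↥ a) ℤ.* (↧ b)) ((↥ b) ℤ.* (↧ a)) ((↧ a) ℤ.* (↧ b)) x y z

HilbertSymbol : (p : ℕ) → ℚ → ℚ → ℤ → Set
HilbertSymbol p a b s =
  (s ≡ + 1 × HilbertSolvable p a b) ⊎ (s ≡ ℤ.-1ℤ × ¬ HilbertSolvable p a b)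

ℤtoℚ : ℤ → ℚ
ℤtoℚ n = n ℚ./ 1

{-# OPTIONS --safe #-}
module Submission where

-- Put nᵢ = kᵢ − λᵢ and c = λ − λ₁ − λ₂. Counting gives k = k₁ + k₂ and 2k₁k₂ = c(v − 1), so σ = n₁n₂ − c + 1.
-- On V = 1^⊥ the matrix N = M₁M₂ᵀ satisfies N + Nᵀ = −c and NNᵀ = n₁n₂, hence S = 2N + c is
-- skew-symmetric on V with SSᵀ = e, where e = 4n₁n₂ − c² and 4σ = e + (c − 2)².
-- If e ≠ 0, then V splits into orthogonal planes ⟨b, Sb⟩ of Gram determinant e|b|⁴, so v − 1 = 2h is even;
-- as V has discriminant v, also v eʰ is a square.
-- For v even this forces e = 0, and σ = ((c − 2)/2)². For v odd it yields an explicit rational solution of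
-- σx² + (−1)ʰ v y² = z². The first symbol equation then follows from the multiplicativity of norms from ℚₚ(√σ),
-- since C(2h, 2) ≡ h (mod 2).
open import Defs
open import Data.Fin as Fin using (Fin; zero; suc)
open import Data.Fin.Properties using (¬Fin0)
open import Data.Integer as ℤ using (ℤ; +_; -1ℤ; 0ℤ; 1ℤ; _+_; _*_; _^_; _-_; -_)
open import Data.Integer.Divisibility using (_∣_)
open import Data.Integer.Divisibility.Signed as Signed using (∣ᵤ⇒∣; ∣⇒∣ᵤ)
import Data.Integer.DivMod as ℤ
import Data.Integer.Properties as ℤ
open import Data.Integer.Tactic.RingSolver using (solve-∀)
open import Data.Nat as ℕ using (ℕ; zero; suc; _≤_; _∸_; _%_; _/_)
open import Data.Nat.Combinatorics using (_C_; nC1≡n; nCk+nC[k+1]≡[n+1]C[k+1])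
import Data.Nat.Divisibility as ℕ
import Data.Nat.DivMod as ℕ
open import Data.Nat.Primality using (Prime; prime⇒nonZero; prime⇒nonTrivial; euclidsLemma)
import Data.Nat.Properties as ℕ
import Data.Nat.Tactic.RingSolver as ℕ
open import Data.Product using (Σ; ∃; _×_; _,_; proj₁; proj₂)
open import Data.Rational as ℚ using (ℚ; 0ℚ; mkℚ; ↥_; ↧_)
import Data.Rational.Properties as ℚ
open import Data.Rational.Unnormalised using (mkℚᵘ; *≡*)
open import Data.Sum using (_⊎_; inj₁; inj₂; map)
open import Data.Unit using (⊤; tt)
open import Data.Vec as Vec using (Vec; []; _∷_)
open import Data.Vec.Relation.Unary.All as All using (All; []; _∷_)
import Data.Vec.Relation.Unary.All.Properties as All
open import Function using (_∘_)
open import Relation.Binary.PropositionalEquality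
open import Relation.Nullary using (¬_; yes; no; contradiction)
open import Relation.Nullary.Decidable using (decidable-stable)

-- The origin of σ: on V, (N + 1)(N + 1)ᵀ = n₁n₂ - c + 1, so N + 1 is a similitude of factor σ.
-- Since 2(N + 1) = S - (c - 2) with S skew, the cross terms cancel and 4σ = e + (c - 2)². The
-- binomial exponent in the theorem is the one by which the Hasse invariant changes when a form of
-- dimension v - 1 is multiplied by σ. Comparing V with σV in this way would require the theory of
-- that invariant; the skew part S splits V into planes instead, so that discriminants suffice. The
-- linear algebra over ℚ is done on integer vectors with denominators cleared. Subspaces are
-- predicates, bases are orthogonal families, and the discriminant is a product of norms up to
-- squares. Dimension and discriminant must be independent of the chosen basis; both facts come from
-- one exchange step that preserves the length of a family and the square class of its product of
-- norms. Locally the obstacle is that vanishing of a `p`-adic integer is not decidable, so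
-- solvability is transferred only up to double negation. This is enough, because the given symbol
-- values already decide solvability.

≢0-* : ∀ {a b} → a ≢ 0ℤ → b ≢ 0ℤ → a * b ≢ 0ℤ
≢0-* {a} a≢0 b≢0 ab≡0 with ℤ.i*j≡0⇒i≡0∨j≡0 a ab≡0
... | inj₁ a≡0 = a≢0 a≡0
... | inj₂ b≡0 = b≢0 b≡0

cancel-≡0 : ∀ {a b} → a ≢ 0ℤ → a * b ≡ 0ℤ → b ≡ 0ℤ
cancel-≡0 {a} a≢0 ab≡0 with ℤ.i*j≡0⇒i≡0∨j≡0 a ab≡0
... | inj₁ a≡0 = contradiction a≡0 a≢0
... | inj₂ b≡0 = b≡0

square-≡0 : ∀ a → a * a ≡ 0ℤ → a ≡ 0ℤ
square-≡0 a aa≡0 with ℤ.i*j≡0⇒i≡0∨j≡0 a aa≡0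
... | inj₁ a≡0 = a≡0
... | inj₂ a≡0 = a≡0

0≤square : ∀ a → 0ℤ ℤ.≤ a * a
0≤square (+ n) = subst (0ℤ ℤ.≤_) (ℤ.pos-* n n) (ℤ.+≤+ ℕ.z≤n)
0≤square ℤ.-[1+ n ] = ℤ.+≤+ ℕ.z≤n

nonneg-sum≡0 : ∀ {a b} → 0ℤ ℤ.≤ a → 0ℤ ℤ.≤ b → a + b ≡ 0ℤ → a ≡ 0ℤ × b ≡ 0ℤ
nonneg-sum≡0 {+ zero} {+ b} _ _ eq = refl , eq

infix 4 _~_

-- Equality of square classes in ℚ*/ℚ*², for integer representatives.
record _~_ (a b : ℤ) : Set where
  constructor mk~
  field
    {s t} : ℤ
    s≢0   : s ≢ 0ℤ
    t≢0   : t ≢ 0ℤ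
    eq    : a * (s * s) ≡ b * (t * t)

1≢0 : 1ℤ ≢ 0ℤ
1≢0 ()

~-reflexive : ∀ {a b} → a ≡ b → a ~ b
~-reflexive refl = mk~ 1≢0 1≢0 refl

~-trans : ∀ {a b c} → a ~ b → b ~ c → a ~ c
~-trans {a} {b} {c} (mk~ {s} {t} s≢0 t≢0 eq) (mk~ {s′} {t′} s′≢0 t′≢0 eq′) =
  mk~ (≢0-* s≢0 s′≢0) (≢0-* t≢0 t′≢0) (begin
    a * (s * s′ * (s * s′))     ≡⟨ shuffle a s s′ ⟩
    a * (s * s) * (s′ * s′)     ≡⟨ cong (_* (s′ * s′)) eq ⟩
    b * (t * t) * (s′ * s′)     ≡⟨ swap b t s′ ⟩
    b * (s′ * s′) * (t * t)     ≡⟨ cong (_* (t * t)) eq′ ⟩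
    c * (t′ * t′) * (t * t)     ≡⟨ swap c t′ t ⟩
    c * (t * t) * (t′ * t′)     ≡⟨ shuffle c t t′ ⟨
    c * (t * t′ * (t * t′))     ∎)
  where
  open ≡-Reasoning
  shuffle : ∀ a s r → a * (s * r * (s * r)) ≡ a * (s * s) * (r * r)
  shuffle = solve-∀
  swap : ∀ b t r → b * (t * t) * (r * r) ≡ b * (r * r) * (t * t)
  swap = solve-∀

~-*ˡ : ∀ c {a b} → a ~ b → c * a ~ c * b
~-*ˡ c {a} {b} (mk~ {s} {t} s≢0 t≢0 eq) = mk~ s≢0 t≢0 (begin
  c * a * (s * s)   ≡⟨ ℤ.*-assoc c a (s * s) ⟩
  c * (a * (s * s)) ≡⟨ cong (c *_) eq ⟩
  c * (b * (t * t)) ≡⟨ ℤ.*-assoc c b (t * t) ⟨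
  c * b * (t * t)   ∎)
  where open ≡-Reasoning

-- Finite sums of integers.

sumFin-cong : ∀ {n} {f g : Fin n → ℤ} → (∀ i → f i ≡ g i) → sumFin f ≡ sumFin g
sumFin-cong {zero}  eq = refl
sumFin-cong {suc n} eq = cong₂ _+_ (eq zero) (sumFin-cong (eq ∘ suc))

sumFin-linear : ∀ {n} a (f : Fin n → ℤ) b g →
                sumFin (λ i → a * f i + b * g i) ≡ a * sumFin f + b * sumFin g
sumFin-linear {zero}  a f b g = base a b
  where
  base : ∀ a b → 0ℤ ≡ a * 0ℤ + b * 0ℤ
  base = solve-∀
sumFin-linear {suc n} a f b g =
  trans (cong (λ t → a * f zero + b * g zero + t) (sumFin-linear a (f ∘ suc) b (g ∘ suc)))
        (step a b (f zero) (g zero) (sumFin (f ∘ suc)) (sumFin (g ∘ suc)))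
  where
  step : ∀ a b x y s t → a * x + b * y + (a * s + b * t) ≡ a * (x + s) + b * (y + t)
  step = solve-∀

sumFin-0 : ∀ {n} → sumFin {n} (λ _ → 0ℤ) ≡ 0ℤ
sumFin-0 {zero}  = refl
sumFin-0 {suc n} = trans (ℤ.+-identityˡ _) (sumFin-0 {n})

sumFin-*ˡ : ∀ {n} a (f : Fin n → ℤ) → sumFin (λ i → a * f i) ≡ a * sumFin f
sumFin-*ˡ {zero}  a f = sym (ℤ.*-zeroʳ a)
sumFin-*ˡ {suc n} a f = trans (cong (λ t → a * f zero + t) (sumFin-*ˡ a (f ∘ suc)))
                              (sym (ℤ.*-distribˡ-+ a (f zero) (sumFin (f ∘ suc))))

sumFin-+ : ∀ {n} (f g : Fin n → ℤ) → sumFin (λ i → f i + g i) ≡ sumFin f + sumFin g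
sumFin-+ f g = trans (sumFin-cong λ i → sym (cong₂ _+_ (ℤ.*-identityˡ (f i)) (ℤ.*-identityˡ (g i))))
  (trans (sumFin-linear 1ℤ f 1ℤ g) (cong₂ _+_ (ℤ.*-identityˡ (sumFin f)) (ℤ.*-identityˡ (sumFin g))))

sumFin-swap : ∀ {m n} (f : Fin m → Fin n → ℤ) →
              sumFin (λ i → sumFin (f i)) ≡ sumFin (λ j → sumFin (λ i → f i j))
sumFin-swap {zero}  {n} f = sym (sumFin-0 {n})
sumFin-swap {suc m}     f = trans (cong (λ t → sumFin (f zero) + t) (sumFin-swap (f ∘ suc)))
                                  (sym (sumFin-+ (f zero) (λ j → sumFin (λ i → f (suc i) j))))

sumFin-const : ∀ n a → sumFin {n} (λ _ → a) ≡ + n * a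
sumFin-const zero    a = sym (ℤ.*-zeroˡ a)
sumFin-const (suc n) a = trans (cong (λ t → a + t) (sumFin-const n a)) (sym (ℤ.suc-* (+ n) a))

sumFin-nonneg : ∀ {n} {f : Fin n → ℤ} → (∀ i → 0ℤ ℤ.≤ f i) → 0ℤ ℤ.≤ sumFin f
sumFin-nonneg {zero}  0≤f = ℤ.≤-refl
sumFin-nonneg {suc n} 0≤f = ℤ.+-mono-≤ (0≤f zero) (sumFin-nonneg (0≤f ∘ suc))

sumFin-nonneg-≡0 : ∀ {n} {f : Fin n → ℤ} → (∀ i → 0ℤ ℤ.≤ f i) → sumFin f ≡ 0ℤ → ∀ i → f i ≡ 0ℤ
sumFin-nonneg-≡0 {suc n} 0≤f eq with nonneg-sum≡0 (0≤f zero) (sumFin-nonneg (0≤f ∘ suc)) eq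
... | p , q = λ { zero → p ; (suc i) → sumFin-nonneg-≡0 (0≤f ∘ suc) q i }

-- Orthogonal families of integer vectors

Vector : ℕ → Set
Vector n = Fin n → ℤ

dot : ∀ {n} → Vector n → Vector n → ℤ
dot x y = sumFin (λ i → x i * y i)

norm : ∀ {n} → Vector n → ℤ
norm x = dot x x

lin : ∀ {n} → ℤ → Vector n → ℤ → Vector n → Vector n
lin a x b y i = a * x i + b * y i

dot-cong : ∀ {n} {x x′ y y′ : Vector n} → (∀ i → x i ≡ x′ i) → (∀ i → y i ≡ y′ i) → dot x y ≡ dot x′ y′
dot-cong p q = sumFin-cong λ i → cong₂ _*_ (p i) (q i)

dot-comm : ∀ {n} (x y : Vector n) → dot x y ≡ dot y x
dot-comm x y = sumFin-cong λ i → ℤ.*-comm (x i) (y i)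

dot-linˡ : ∀ {n} a (x : Vector n) b y z → dot (lin a x b y) z ≡ a * dot x z + b * dot y z
dot-linˡ a x b y z =
  trans (sumFin-cong λ i → distrib a (x i) b (y i) (z i))
        (sumFin-linear a (λ i → x i * z i) b (λ i → y i * z i))
  where
  distrib : ∀ a x b y z → (a * x + b * y) * z ≡ a * (x * z) + b * (y * z)
  distrib = solve-∀

dot-linʳ : ∀ {n} a (x : Vector n) b y z → dot z (lin a x b y) ≡ a * dot z x + b * dot z y
dot-linʳ a x b y z = trans (dot-comm z (lin a x b y))
  (trans (dot-linˡ a x b y z) (cong₂ (λ s t → a * s + b * t) (dot-comm x z) (dot-comm y z)))

0ᵛ : ∀ {n} → Vector n
0ᵛ _ = 0ℤ

dot-0ˡ : ∀ {n} (y : Vector n) → dot 0ᵛ y ≡ 0ℤ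
dot-0ˡ {n} y = trans (sumFin-cong λ i → ℤ.*-zeroˡ (y i)) (sumFin-0 {n})

-- Positive definiteness of the standard form. Vanishing is phrased through pairings, so no equality
-- of functions is needed.
norm-≡0 : ∀ {n} (x : Vector n) → norm x ≡ 0ℤ → ∀ y → dot x y ≡ 0ℤ
norm-≡0 x eq y =
  trans (dot-cong (λ i → square-≡0 (x i) (sumFin-nonneg-≡0 (λ j → 0≤square (x j)) eq i)) (λ _ → refl))
        (dot-0ˡ y)

record Closed {n} (P : Vector n → Set) : Set where
  field
    0∈   : P 0ᵛ
    lin∈ : ∀ a {x} b {y} → P x → P y → P (lin a x b y)
open Closed

infixl 6 _∩⟂_

_∩⟂_ : ∀ {n} → (Vector n → Set) → Vector n → (Vector n → Set)
(P ∩⟂ u) x = P x × dot u x ≡ 0ℤ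

lin-zeros : ∀ a b {s t} → s ≡ 0ℤ → t ≡ 0ℤ → a * s + b * t ≡ 0ℤ
lin-zeros a b refl refl = cong₂ _+_ (ℤ.*-zeroʳ a) (ℤ.*-zeroʳ b)

⟂-closed : ∀ {n} (u : Vector n) → Closed (λ x → dot u x ≡ 0ℤ)
⟂-closed u .0∈ = trans (dot-comm u 0ᵛ) (dot-0ˡ u)
⟂-closed u .lin∈ a {x} b {y} p q = trans (dot-linʳ a x b y u) (lin-zeros a b p q)

∩⟂-closed : ∀ {n} {P : Vector n → Set} → Closed P → ∀ u → Closed (P ∩⟂ u)
∩⟂-closed cl u .0∈ = cl .0∈ , ⟂-closed u .0∈
∩⟂-closed cl u .lin∈ a b (p , p′) (q , q′) = cl .lin∈ a b p q , ⟂-closed u .lin∈ a b p′ q′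

comb : ∀ {n m} → Vec ℤ m → Vec (Vector n) m → Vector n
comb []       []       = 0ᵛ
comb (c ∷ cs) (b ∷ bs) = lin c b 1ℤ (comb cs bs)

comb∈ : ∀ {n m} {P : Vector n → Set} → Closed P → ∀ (cs : Vec ℤ m) {bs} → All P bs → P (comb cs bs)
comb∈ cl []       []       = cl .0∈
comb∈ cl (c ∷ cs) (p ∷ ps) = cl .lin∈ c 1ℤ p (comb∈ cl cs ps)

dot-comb-scale : ∀ {n m} a (cs : Vec ℤ m) (bs : Vec (Vector n) m) y →
                 dot (comb (Vec.map (a *_) cs) bs) y ≡ a * dot (comb cs bs) y
dot-comb-scale a [] [] y = trans (dot-0ˡ y) (sym (trans (cong (a *_) (dot-0ˡ y)) (ℤ.*-zeroʳ a)))
dot-comb-scale a (c ∷ cs) (b ∷ bs) y = begin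
  dot (lin (a * c) b 1ℤ (comb (Vec.map (a *_) cs) bs)) y   ≡⟨ dot-linˡ (a * c) b 1ℤ _ y ⟩
  a * c * dot b y + 1ℤ * dot (comb (Vec.map (a *_) cs) bs) y
    ≡⟨ cong (λ t → a * c * dot b y + 1ℤ * t) (dot-comb-scale a cs bs y) ⟩
  a * c * dot b y + 1ℤ * (a * dot (comb cs bs) y)          ≡⟨ factor a c (dot b y) _ ⟩
  a * (c * dot b y + 1ℤ * dot (comb cs bs) y)              ≡⟨ cong (a *_) (dot-linˡ c b 1ℤ _ y) ⟨
  a * dot (lin c b 1ℤ (comb cs bs)) y                      ∎
  where
  open ≡-Reasoning
  factor : ∀ a c s t → a * c * s + 1ℤ * (a * t) ≡ a * (c * s + 1ℤ * t)
  factor = solve-∀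

-- Orthogonal families and the exchange of a vector.

data Orthogonal {n} : ∀ {m} → Vec (Vector n) m → Set where
  []    : Orthogonal []
  cons  : ∀ {m b} {bs : Vec (Vector n) m} →
          norm b ≢ 0ℤ → All (λ c → dot b c ≡ 0ℤ) bs → Orthogonal bs → Orthogonal (b ∷ bs)

-- The Gram determinant, the Gram matrix of an orthogonal family being diagonal; its square class is
-- the discriminant of the rational span.
gramProduct : ∀ {n m} → Vec (Vector n) m → ℤ
gramProduct []       = 1ℤ
gramProduct (b ∷ bs) = norm b * gramProduct bs

norm-lin-⟂ : ∀ {n} a (x : Vector n) b y → dot x y ≡ 0ℤ →
             norm (lin a x b y) ≡ a * a * norm x + b * b * norm y
norm-lin-⟂ a x b y x⟂y = begin
  norm (lin a x b y)                                      ≡⟨ dot-linˡ a x b y _ ⟩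
  a * dot x (lin a x b y) + b * dot y (lin a x b y)
    ≡⟨ cong₂ (λ s t → a * s + b * t) (dot-linʳ a x b y x) (dot-linʳ a x b y y) ⟩
  a * (a * norm x + b * dot x y) + b * (a * dot y x + b * norm y)
    ≡⟨ cong₂ (λ s t → a * (a * norm x + b * s) + b * (a * t + b * norm y)) x⟂y (trans (dot-comm y x) x⟂y) ⟩
  a * (a * norm x + b * 0ℤ) + b * (a * 0ℤ + b * norm y)  ≡⟨ simplify a b (norm x) (norm y) ⟩
  a * a * norm x + b * b * norm y                         ∎
  where
  open ≡-Reasoning
  simplify : ∀ a b s t → a * (a * s + b * 0ℤ) + b * (a * 0ℤ + b * t) ≡ a * a * s + b * b * t
  simplify = solve-∀

-- Steinitz exchange inside the rational span of `bs`: `w` together with `rest` is another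
-- orthogonal basis of it. Containment of `rest` in the span is expressed by `within`, as membership
-- in every closed predicate that holds on `bs`; the opposite containment is expressed by `recover`,
-- through orthogonal complements.
record Exchange {n m} (bs : Vec (Vector n) (suc m)) (w : Vector n) : Set₁ where
  field
    rest       : Vec (Vector n) m
    orthogonal : Orthogonal rest
    w⟂rest     : All (λ c → dot w c ≡ 0ℤ) rest
    recover    : ∀ x → dot x w ≡ 0ℤ → All (λ c → dot x c ≡ 0ℤ) rest → All (λ c → dot x c ≡ 0ℤ) bs
    within     : ∀ {P} → Closed P → All P bs → All P rest
    gram       : gramProduct bs ~ norm w * gramProduct rest

-- By definiteness `u` vanishes, so `w` is in effect c b with c ≠ 0 and takes the place of `b`,
-- changing the Gram product by c².
exchange-head : ∀ {n m} c (b : Vector n) (bs : Vec (Vector n) m) u → Orthogonal (b ∷ bs) →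
                norm u ≡ 0ℤ → norm (lin c b 1ℤ u) ≢ 0ℤ → Exchange (b ∷ bs) (lin c b 1ℤ u)
exchange-head c b bs u (cons _ b⟂bs orth) |u|≡0 |w|≢0 = record
  { rest       = bs
  ; orthogonal = orth
  ; w⟂rest     = All.map (λ {d} b⟂d → trans (dot-linˡ c b 1ℤ u d) (lin-zeros c 1ℤ b⟂d (u⟂ d))) b⟂bs
  ; recover    = λ x x⟂w x⟂bs → cancel-≡0 c≢0 (trans (sym (x·w x)) x⟂w) ∷ x⟂bs
  ; within     = λ { _ (_ ∷ ps) → ps }
  ; gram       = mk~ c≢0 1≢0 (trans (regroup c (norm b) (gramProduct bs))
                   (cong (λ t → t * gramProduct bs * (1ℤ * 1ℤ)) (sym |w|)))
  }
  where
  w = lin c b 1ℤ u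
  u⟂ : ∀ d → dot u d ≡ 0ℤ
  u⟂ = norm-≡0 u |u|≡0
  |w| : norm w ≡ c * c * norm b
  |w| = trans (norm-lin-⟂ c b 1ℤ u (trans (dot-comm b u) (u⟂ b)))
    (trans (cong (λ t → c * c * norm b + 1ℤ * 1ℤ * t) |u|≡0) (ℤ.+-identityʳ _))
  c≢0 : c ≢ 0ℤ
  c≢0 refl = |w|≢0 (trans |w| (ℤ.*-zeroˡ (norm b)))
  x·w : ∀ x → dot x w ≡ c * dot x b
  x·w x = trans (dot-linʳ c b 1ℤ u x)
    (trans (cong (λ t → c * dot x b + 1ℤ * t) (trans (dot-comm x u) (u⟂ x))) (ℤ.+-identityʳ _))
  regroup : ∀ c q g → q * g * (c * c) ≡ c * c * q * g * (1ℤ * 1ℤ)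
  regroup = solve-∀

-- The plane spanned by b and u is also spanned by the orthogonal vectors w and
-- f = |u|² b − c |b|² u, and |f|² = |u|² |b|² |w|².
exchange-plane : ∀ {n m} c (b : Vector n) (bs : Vec (Vector n) (suc m)) u → Orthogonal (b ∷ bs) →
                 (∀ {P} → Closed P → All P bs → P u) → norm u ≢ 0ℤ → Exchange bs u →
                 norm (lin c b 1ℤ u) ≢ 0ℤ → Exchange (b ∷ bs) (lin c b 1ℤ u)
exchange-plane c b bs u (cons |b|≢0 b⟂bs _) u∈ |u|≢0 E |w|≢0 = record
  { rest       = f ∷ E.rest
  ; orthogonal = cons |f|≢0 (lin⟂ (norm u) (- (c * norm b))) E.orthogonal
  ; w⟂rest     = w⟂f ∷ lin⟂ c 1ℤ
  ; recover    = recover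
  ; within     = λ { cl (p ∷ ps) → cl .lin∈ (norm u) (- (c * norm b)) p (u∈ cl ps) ∷ E.within cl ps }
  ; gram       = gram E.gram
  }
  where
  module E = Exchange E
  w f : Vector _
  w = lin c b 1ℤ u
  f = lin (norm u) b (- (c * norm b)) u
  -- The complement of `b` is closed and contains `bs`, hence also `u`.
  b⟂u : dot b u ≡ 0ℤ
  b⟂u = u∈ (⟂-closed b) b⟂bs
  |w| : norm w ≡ c * c * norm b + norm u
  |w| = trans (norm-lin-⟂ c b 1ℤ u b⟂u) (cong (λ t → c * c * norm b + t) (ℤ.*-identityˡ (norm u)))
  |f| : norm f ≡ norm u * norm b * norm w
  |f| = trans (norm-lin-⟂ (norm u) b (- (c * norm b)) u b⟂u)
          (trans (factor (norm u) (norm b) c) (cong (norm u * norm b *_) (sym |w|)))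
    where
    factor : ∀ r q c → r * r * q + - (c * q) * - (c * q) * r ≡ r * q * (c * c * q + r)
    factor = solve-∀
  |f|≢0 : norm f ≢ 0ℤ
  |f|≢0 eq = ≢0-* (≢0-* |u|≢0 |b|≢0) |w|≢0 (trans (sym |f|) eq)
  lin⟂ : ∀ a a′ → All (λ d → dot (lin a b a′ u) d ≡ 0ℤ) E.rest
  lin⟂ a a′ = All.map (λ {d} (p , q) → trans (dot-linˡ a b a′ u d) (lin-zeros a a′ p q))
                          (All.zip (E.within (⟂-closed b) b⟂bs , E.w⟂rest))
  w⟂f : dot w f ≡ 0ℤ
  w⟂f = begin
    dot w f                                         ≡⟨ dot-linˡ c b 1ℤ u f ⟩
    c * dot b f + 1ℤ * dot u f
      ≡⟨ cong₂ (λ s t → c * s + 1ℤ * t) (dot-linʳ (norm u) b (- (c * norm b)) u b) (dot-linʳ (norm u) b (- (c * norm b)) u u) ⟩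
    c * (norm u * norm b + - (c * norm b) * dot b u) + 1ℤ * (norm u * dot u b + - (c * norm b) * norm u)
      ≡⟨ cong₂ (λ s t → c * (norm u * norm b + - (c * norm b) * s) + 1ℤ * (norm u * t + - (c * norm b) * norm u))
               b⟂u (trans (dot-comm u b) b⟂u) ⟩
    c * (norm u * norm b + - (c * norm b) * 0ℤ) + 1ℤ * (norm u * 0ℤ + - (c * norm b) * norm u)
      ≡⟨ vanish c (norm b) (norm u) ⟩
    0ℤ                                              ∎
    where
    open ≡-Reasoning
    vanish : ∀ c q r → c * (r * q + - (c * q) * 0ℤ) + 1ℤ * (r * 0ℤ + - (c * q) * r) ≡ 0ℤ
    vanish = solve-∀
  recover : ∀ x → dot x w ≡ 0ℤ → All (λ d → dot x d ≡ 0ℤ) (f ∷ E.rest) →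
            All (λ d → dot x d ≡ 0ℤ) (b ∷ bs)
  recover x x⟂w (x⟂f ∷ x⟂rest) = x⟂b ∷ E.recover x x⟂u x⟂rest
    where
    α = dot x b
    β = dot x u
    eq₁ : c * α + 1ℤ * β ≡ 0ℤ
    eq₁ = trans (sym (dot-linʳ c b 1ℤ u x)) x⟂w
    eq₂ : norm u * α + - (c * norm b) * β ≡ 0ℤ
    eq₂ = trans (sym (dot-linʳ (norm u) b (- (c * norm b)) u x)) x⟂f
    -- Cramer's rule for `eq₁` and `eq₂`: up to sign, the determinant of this system in α and β is
    -- |w|², which is nonzero.
    eliminate : ∀ c q r α β → (c * c * q + r) * α ≡ (c * q) * (c * α + 1ℤ * β) + 1ℤ * (r * α + - (c * q) * β)
    eliminate = solve-∀
    x⟂b : α ≡ 0ℤ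
    x⟂b = cancel-≡0 |w|≢0 (trans (cong (_* α) |w|)
            (trans (eliminate c (norm b) (norm u) α β) (lin-zeros (c * norm b) 1ℤ eq₁ eq₂)))
    x⟂u : β ≡ 0ℤ
    x⟂u = begin
      β                ≡⟨ isolate c α β ⟩
      1ℤ * (c * α + 1ℤ * β) + - c * α ≡⟨ lin-zeros 1ℤ (- c) eq₁ x⟂b ⟩
      0ℤ               ∎
      where
      open ≡-Reasoning
      isolate : ∀ c α β → β ≡ 1ℤ * (c * α + 1ℤ * β) + - c * α
      isolate = solve-∀
  gram : gramProduct bs ~ norm u * gramProduct E.rest →
         norm b * gramProduct bs ~ norm w * (norm f * gramProduct E.rest)
  gram (mk~ {s} {t} s≢0 t≢0 eq) =
    mk~ (≢0-* s≢0 (≢0-* |u|≢0 |w|≢0)) (≢0-* t≢0 |u|≢0) (begin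
      B * G * (s * (U * W) * (s * (U * W)))     ≡⟨ regroup₁ B G s U W ⟩
      G * (s * s) * (B * U * U * W * W)         ≡⟨ cong (_* (B * U * U * W * W)) eq ⟩
      U * H * (t * t) * (B * U * U * W * W)     ≡⟨ regroup₂ B H t U W ⟩
      W * (U * B * W * H) * (t * U * (t * U))   ≡⟨ cong (λ z → W * (z * H) * (t * U * (t * U))) |f| ⟨
      W * (norm f * H) * (t * U * (t * U))      ∎)
    where
    open ≡-Reasoning
    B = norm b ; U = norm u ; W = norm w ; G = gramProduct bs ; H = gramProduct E.rest
    regroup₁ : ∀ B G s U W → B * G * (s * (U * W) * (s * (U * W))) ≡ G * (s * s) * (B * U * U * W * W)
    regroup₁ = solve-∀
    regroup₂ : ∀ B H t U W → U * H * (t * t) * (B * U * U * W * W) ≡ W * (U * B * W * H) * (t * U * (t * U))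
    regroup₂ = solve-∀

-- Recursion on the family. If the combination of the tail is zero, only the head matters. Otherwise
-- that combination is first exchanged into the tail, and then only the plane it spans with the head
-- has to be given a new orthogonal basis.
exchange : ∀ {n m} (cs : Vec ℤ (suc m)) (bs : Vec (Vector n) (suc m)) → Orthogonal bs →
           norm (comb cs bs) ≢ 0ℤ → Exchange bs (comb cs bs)
exchange {n} (c ∷ [])     (b ∷ [])     orth |w|≢0 = exchange-head c b [] 0ᵛ orth (dot-0ˡ {n} 0ᵛ) |w|≢0
exchange (c ∷ c′ ∷ cs) (b ∷ b′ ∷ bs) orth@(cons _ _ orth′) |w|≢0 with norm (comb (c′ ∷ cs) (b′ ∷ bs)) ℤ.≟ 0ℤ
... | yes |u|≡0 = exchange-head c b (b′ ∷ bs) _ orth |u|≡0 |w|≢0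
... | no  |u|≢0 = exchange-plane c b (b′ ∷ bs) _ orth (λ cl → comb∈ cl (c′ ∷ cs)) |u|≢0
                    (exchange (c′ ∷ cs) (b′ ∷ bs) orth′ |u|≢0) |w|≢0

-- Projections, frames and splitting off a vector.

record Projection {n m} (bs : Vec (Vector n) m) (u : Vector n) : Set where
  field
    {scale}   : ℤ
    scale≢0   : scale ≢ 0ℤ
    coeffs    : Vec ℤ m
    residual⟂ : All (λ d → dot (lin scale u -1ℤ (comb coeffs bs)) d ≡ 0ℤ) bs

-- Gram-Schmidt without division. The coefficient of `b` in the projection of `u` is (u·b)/|b|².
-- Over the common denominator D|b|², with D the scale of the tail, it becomes D(u·b), and the tail
-- coefficients acquire the factor |b|².
project : ∀ {n m} (bs : Vec (Vector n) m) → Orthogonal bs → ∀ u → Projection bs u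
project []       _ u = record { scale = 1ℤ ; scale≢0 = 1≢0 ; coeffs = [] ; residual⟂ = [] }
project (b ∷ bs) (cons |b|≢0 b⟂bs orth) u = record
  { scale≢0   = ≢0-* R.scale≢0 |b|≢0
  ; coeffs    = R.scale * dot u b ∷ Vec.map (norm b *_) R.coeffs
  ; residual⟂ = res⟂b ∷ All.map (λ {d} (p , q) → res⟂ d p q) (All.zip (b⟂bs , R.residual⟂))
  }
  where
  open ≡-Reasoning
  module R = Projection (project bs orth u)
  B = norm b
  D = R.scale
  w = comb R.coeffs bs
  cs′ = Vec.map (B *_) R.coeffs
  unfold : ∀ d → dot (lin (D * B) u -1ℤ (lin (D * dot u b) b 1ℤ (comb cs′ bs))) d
               ≡ D * B * dot u d + -1ℤ * (D * dot u b * dot b d + 1ℤ * (B * dot w d))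
  unfold d = trans (dot-linˡ (D * B) u -1ℤ (lin (D * dot u b) b 1ℤ (comb cs′ bs)) d) (cong (λ t → D * B * dot u d + -1ℤ * t)
    (trans (dot-linˡ (D * dot u b) b 1ℤ (comb cs′ bs) d) (cong (λ t → D * dot u b * dot b d + 1ℤ * t) (dot-comb-scale B R.coeffs bs d))))
  res⟂b : _
  res⟂b = begin
    _                                                              ≡⟨ unfold b ⟩
    D * B * dot u b + -1ℤ * (D * dot u b * B + 1ℤ * (B * dot w b))
      ≡⟨ cong (λ t → D * B * dot u b + -1ℤ * (D * dot u b * B + 1ℤ * (B * t)))
              (trans (dot-comm w b) (comb∈ (⟂-closed b) R.coeffs b⟂bs)) ⟩
    D * B * dot u b + -1ℤ * (D * dot u b * B + 1ℤ * (B * 0ℤ))      ≡⟨ vanish D B (dot u b) ⟩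
    0ℤ                                                             ∎
    where
    vanish : ∀ D B s → D * B * s + -1ℤ * (D * s * B + 1ℤ * (B * 0ℤ)) ≡ 0ℤ
    vanish = solve-∀
  res⟂ : ∀ d → dot b d ≡ 0ℤ → dot (lin D u -1ℤ w) d ≡ 0ℤ → _
  res⟂ d b⟂d r⟂d = begin
    _                                                                        ≡⟨ unfold d ⟩
    D * B * dot u d + -1ℤ * (D * dot u b * dot b d + 1ℤ * (B * dot w d))
      ≡⟨ regroup D B (dot u d) (dot u b) (dot b d) (dot w d) ⟩
    B * (D * dot u d + -1ℤ * dot w d) + - (D * dot u b) * dot b d
      ≡⟨ lin-zeros B (- (D * dot u b)) (trans (sym (dot-linˡ D u -1ℤ w d)) r⟂d) b⟂d ⟩
    0ℤ                                                                       ∎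
    where
    regroup : ∀ D B s r t z → D * B * s + -1ℤ * (D * r * t + 1ℤ * (B * z)) ≡ B * (D * s + -1ℤ * z) + - (D * r) * t
    regroup = solve-∀

-- An orthogonal basis of the rational span of P.
record Frame {n} (P : Vector n → Set) {m} (bs : Vec (Vector n) m) : Set where
  field
    orthogonal : Orthogonal bs
    members    : All P bs
    maximal    : ∀ x → P x → All (λ d → dot x d ≡ 0ℤ) bs → norm x ≡ 0ℤ

Frame-tail : ∀ {n m} {P : Vector n → Set} {b} {bs : Vec (Vector n) m} → Frame P (b ∷ bs) → Frame (P ∩⟂ b) bs
Frame-tail {b = b} record { orthogonal = cons _ b⟂bs orth ; members = _ ∷ ps ; maximal = max } = record
  { orthogonal = orth
  ; members    = All.zip (ps , b⟂bs)
  ; maximal    = λ x (px , b⟂x) x⟂bs → max x px (trans (dot-comm x b) b⟂x ∷ x⟂bs)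
  }

record Expansion {n m} (bs : Vec (Vector n) m) (u : Vector n) : Set where
  field
    {scale} : ℤ
    scale≢0 : scale ≢ 0ℤ
    coeffs  : Vec ℤ m
    expands : ∀ y → scale * dot u y ≡ dot (comb coeffs bs) y

  norm-expands : norm (comb coeffs bs) ≡ scale * scale * norm u
  norm-expands = begin
    norm w                     ≡⟨ expands w ⟨
    scale * dot u w            ≡⟨ cong (scale *_) (trans (dot-comm u w) (sym (expands u))) ⟩
    scale * (scale * norm u)   ≡⟨ ℤ.*-assoc scale scale (norm u) ⟨
    scale * scale * norm u     ∎
    where
    open ≡-Reasoning
    w = comb coeffs bs

-- The residual of the projection lies in `P` and is orthogonal to the frame, so `maximal` makes it
-- vanish.
expand : ∀ {n m} {P : Vector n → Set} {bs : Vec (Vector n) m} → Closed P → Frame P bs →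
         ∀ u → P u → Expansion bs u
expand {bs = bs} cl F u pu = record
  { scale≢0 = scale≢0
  ; coeffs  = coeffs
  ; expands = λ y → ℤ.i-j≡0⇒i≡j _ _ (trans (cong (λ t → scale * dot u y + t) (sym (ℤ.-1*i≡-i _)))
      (trans (sym (dot-linˡ scale u -1ℤ w y)) (norm-≡0 r |r|≡0 y)))
  }
  where
  open Projection (project bs (Frame.orthogonal F) u)
  w = comb coeffs bs
  r = lin scale u -1ℤ w
  |r|≡0 : norm r ≡ 0ℤ
  |r|≡0 = Frame.maximal F r (cl .lin∈ scale -1ℤ pu (comb∈ cl coeffs (Frame.members F))) residual⟂

Frame-[] : ∀ {n} {P : Vector n → Set} → Frame P [] → ∀ u → P u → norm u ≡ 0ℤ
Frame-[] F u pu = Frame.maximal F u pu []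

record Split {n} (P : Vector n → Set) {m} (bs : Vec (Vector n) (suc m)) (u : Vector n) : Set where
  field
    {rest} : Vec (Vector n) m
    frame  : Frame (P ∩⟂ u) rest
    gram   : gramProduct bs ~ norm u * gramProduct rest

-- Only the multiple `scale` · u need be an integral combination of the frame, so this multiple is
-- exchanged in place of `u`; it has the same orthogonal complement, and its norm differs from that
-- of `u` by a square. The drop in length by exactly one takes the place of a dimension count.
split : ∀ {n m} {P : Vector n → Set} {bs : Vec (Vector n) (suc m)} → Closed P → Frame P bs →
        ∀ u → P u → norm u ≢ 0ℤ → Split P bs u
split {P = P} {bs} cl F u pu |u|≢0 = record
  { frame = record
    { orthogonal = E.orthogonal
    ; members    = All.map (λ {d} (p , w⟂d) → p , cancel-≡0 scale≢0 (trans (expands d) w⟂d))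
                     (All.zip (E.within cl F.members , E.w⟂rest))
    ; maximal    = λ x (px , u⟂x) x⟂rest → F.maximal x px
                     (E.recover x (trans (dot-comm x w) (trans (sym (expands x)) (trans (cong (scale *_) u⟂x) (ℤ.*-zeroʳ scale)))) x⟂rest)
    }
  ; gram  = ~-trans E.gram (mk~ 1≢0 scale≢0 (trans (cong (λ t → t * G * (1ℤ * 1ℤ)) norm-expands) (regroup scale (norm u) G)))
  }
  where
  module F = Frame F
  open Expansion (expand cl F u pu)
  w = comb coeffs bs
  |w|≢0 : norm w ≢ 0ℤ
  |w|≢0 eq = ≢0-* (≢0-* scale≢0 scale≢0) |u|≢0 (trans (sym norm-expands) eq)
  module E = Exchange (exchange coeffs bs F.orthogonal |w|≢0)
  G = gramProduct E.rest
  regroup : ∀ D q g → D * D * q * g * (1ℤ * 1ℤ) ≡ q * g * (D * D)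
  regroup = solve-∀

-- Discriminant of a space with a skew similitude.

record SkewSimilitude {n} (P : Vector n → Set) (S : Vector n → Vector n) (e : ℤ) : Set where
  field
    closed     : Closed P
    preserves  : ∀ {x} → P x → P (S x)
    skew       : ∀ {x y} → P x → P y → dot (S x) y ≡ - dot x (S y)
    similitude : ∀ {x y} → P x → P y → dot (S x) (S y) ≡ e * dot x y

i≡-i⇒i≡0 : ∀ i → i ≡ - i → i ≡ 0ℤ
i≡-i⇒i≡0 (+ zero) _ = refl

-- Each vector b of P spans with S b an S-invariant plane of Gram determinant e |b|⁴;
-- its orthogonal complement in P is again S-invariant.
gram-skew : ∀ {n m} {P : Vector n → Set} {S e} {bs : Vec (Vector n) m} → SkewSimilitude P S e →
            e ≢ 0ℤ → Frame P bs → ∃ λ h → m ≡ 2 ℕ.* h × gramProduct bs ~ e ^ h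
gram-skew {bs = []} _ _ _ = 0 , refl , ~-reflexive refl
gram-skew {P = P} {S} {e} {b ∷ bs} 𝓢 e≢0 F@record { orthogonal = cons |b|≢0 _ _ ; members = pb ∷ _ } = go bs (Frame-tail F)
  where
  module 𝓢 = SkewSimilitude 𝓢
  P₁ = P ∩⟂ b
  P₂ = P₁ ∩⟂ S b
  Sb⟂b : dot (S b) b ≡ 0ℤ
  Sb⟂b = i≡-i⇒i≡0 _ (trans (𝓢.skew pb pb) (cong -_ (dot-comm b (S b))))
  Sb∈ : P₁ (S b)
  Sb∈ = 𝓢.preserves pb , trans (dot-comm b (S b)) Sb⟂b
  |Sb|≢0 : norm (S b) ≢ 0ℤ
  |Sb|≢0 eq = ≢0-* e≢0 |b|≢0 (trans (sym (𝓢.similitude pb pb)) eq)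
  P₁-closed : Closed P₁
  P₁-closed = ∩⟂-closed 𝓢.closed b
  𝓢₂ : SkewSimilitude P₂ S e
  𝓢₂ = record
    { closed     = ∩⟂-closed P₁-closed (S b)
    ; preserves  = λ { {x} ((px , b⟂x) , Sb⟂x) →
        (𝓢.preserves px , trans (sym (ℤ.neg-involutive _)) (cong -_ (trans (sym (𝓢.skew pb px)) Sb⟂x)))
        , trans (𝓢.similitude pb px) (trans (cong (e *_) b⟂x) (ℤ.*-zeroʳ e)) }
    ; skew       = λ { ((px , _) , _) ((py , _) , _) → 𝓢.skew px py }
    ; similitude = λ { ((px , _) , _) ((py , _) , _) → 𝓢.similitude px py }
    }
  go : ∀ {m} (bs : Vec (Vector _) m) → Frame P₁ bs →
       ∃ λ h → suc m ≡ 2 ℕ.* h × norm b * gramProduct bs ~ e ^ h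
  -- Dimension one is impossible: S b is a nonzero vector of `P` orthogonal to `b`.
  go []         F₁ = contradiction (Frame-[] F₁ (S b) Sb∈) |Sb|≢0
  go bs@(_ ∷ _) F₁ with split P₁-closed F₁ (S b) Sb∈ |Sb|≢0
  ... | record { rest = rest ; frame = F₂ ; gram = g } with gram-skew 𝓢₂ e≢0 F₂
  ...   | h , refl , g′ = suc h , cong suc (sym (ℕ.+-suc h (h ℕ.+ 0))) ,
    ~-trans (~-*ˡ (norm b) g) (~-trans
      (mk~ 1≢0 |b|≢0 (trans (cong (λ t → norm b * (t * gramProduct rest) * (1ℤ * 1ℤ)) (𝓢.similitude pb pb))
                            (regroup (norm b) e (gramProduct rest))))
      (~-*ˡ e g′))
    where
    regroup : ∀ q e g → q * (e * q * g) * (1ℤ * 1ℤ) ≡ e * g * (q * q)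
    regroup = solve-∀

-- Symmetric designs

I-suc : ∀ {n} (i j : Fin n) → I (suc i) (suc j) ≡ I i j
I-suc i j with i Fin.≟ j
... | yes _ = refl
... | no  _ = refl

I-diag : ∀ {n} (i : Fin n) → I i i ≡ 1ℤ
I-diag i with i Fin.≟ i
... | yes _   = refl
... | no  i≢i = contradiction refl i≢i

I-off : ∀ {n} {i j : Fin n} → i ≢ j → I i j ≡ 0ℤ
I-off {i = i} {j} i≢j with i Fin.≟ j
... | yes i≡j = contradiction i≡j i≢j
... | no  _   = refl

dot-I : ∀ {n} (i : Fin n) y → dot (I i) y ≡ y i
dot-I zero y = begin
  1ℤ * y zero + dot (λ _ → 0ℤ) (y ∘ suc) ≡⟨ cong₂ _+_ (ℤ.*-identityˡ (y zero)) (dot-0ˡ (y ∘ suc)) ⟩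
  y zero + 0ℤ                            ≡⟨ ℤ.+-identityʳ (y zero) ⟩
  y zero                                 ∎
  where open ≡-Reasoning
dot-I (suc i) y = begin
  0ℤ * y zero + dot (λ j → I (suc i) (suc j)) (y ∘ suc)
    ≡⟨ cong₂ _+_ (ℤ.*-zeroˡ (y zero)) (dot-cong {y = y ∘ suc} (I-suc i) (λ _ → refl)) ⟩
  0ℤ + dot (I i) (y ∘ suc)  ≡⟨ ℤ.+-identityˡ _ ⟩
  dot (I i) (y ∘ suc)       ≡⟨ dot-I i (y ∘ suc) ⟩
  y (suc i)                 ∎
  where open ≡-Reasoning

Orthogonal-tabulate : ∀ {n m} (f : Fin m → Vector n) → (∀ i → norm (f i) ≢ 0ℤ) →
                      (∀ {i j} → i ≢ j → dot (f i) (f j) ≡ 0ℤ) → Orthogonal (Vec.tabulate f)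
Orthogonal-tabulate {m = zero}  f |f|≢0 f⟂f = []
Orthogonal-tabulate {m = suc m} f |f|≢0 f⟂f =
  cons (|f|≢0 zero) (All.tabulate⁺ λ j → f⟂f λ ())
       (Orthogonal-tabulate (f ∘ suc) (|f|≢0 ∘ suc) (λ i≢j → f⟂f λ { refl → i≢j refl }))

gramProduct-tabulate : ∀ {n m} (f : Fin m → Vector n) → (∀ i → norm (f i) ≡ 1ℤ) →
                       gramProduct (Vec.tabulate f) ≡ 1ℤ
gramProduct-tabulate {m = zero}  f |f|≡1 = refl
gramProduct-tabulate {m = suc m} f |f|≡1 =
  cong₂ _*_ (|f|≡1 zero) (gramProduct-tabulate (f ∘ suc) (|f|≡1 ∘ suc))

-- The sum-zero hyperplane and its discriminant.

Full : ∀ {n} → Vector n → Set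
Full _ = ⊤

Full-closed : ∀ {n} → Closed (Full {n})
Full-closed = record { 0∈ = tt ; lin∈ = λ _ _ _ _ → tt }

norm-I : ∀ {n} (i : Fin n) → norm (I i) ≡ 1ℤ
norm-I i = trans (dot-I i (I i)) (I-diag i)

standardFrame : ∀ n → Frame Full (Vec.tabulate (I {n}))
standardFrame n = record
  { orthogonal = Orthogonal-tabulate I (λ i eq → 1≢0 (trans (sym (norm-I i)) eq))
                   (λ {i} {j} i≢j → trans (dot-I i (I j)) (I-off (i≢j ∘ sym)))
  ; members    = All.tabulate⁺ (λ _ → tt)
  ; maximal    = λ x _ x⟂I → trans
      (dot-cong {y = x} (λ i → trans (sym (trans (dot-comm x (I i)) (dot-I i x))) (All.tabulate⁻ x⟂I i)) (λ _ → refl))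
      (dot-0ˡ x)
  }

1ᵛ : ∀ {n} → Vector n
1ᵛ _ = 1ℤ

dot-1ˡ : ∀ {n} (x : Vector n) → dot 1ᵛ x ≡ sumFin x
dot-1ˡ x = sumFin-cong (ℤ.*-identityˡ ∘ x)

norm-1 : ∀ n → norm (1ᵛ {n}) ≡ + n
norm-1 n = trans (sumFin-const n 1ℤ) (ℤ.*-identityʳ (+ n))

SumZero : ∀ {n} → Vector n → Set
SumZero = Full ∩⟂ 1ᵛ

sum-zero : ∀ {n} {x : Vector n} → SumZero x → sumFin x ≡ 0ℤ
sum-zero {x = x} (_ , 1⟂x) = trans (sym (dot-1ˡ x)) 1⟂x

-- The standard basis has Gram product 1. Splitting off the all-ones vector, of norm v = m + 1,
-- leaves a frame of its complement.
sumZeroFrame : ∀ m → ∃ λ (bs : Vec (Vector (suc m)) m) → Frame SumZero bs × 1ℤ ~ + suc m * gramProduct bs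
sumZeroFrame m = rest , frame ,
  ~-trans (~-reflexive (sym (gramProduct-tabulate (I {suc m}) norm-I)))
          (subst (λ t → gramProduct (Vec.tabulate (I {suc m})) ~ t * gramProduct rest) (norm-1 (suc m)) gram)
  where
  |1|≢0 : norm (1ᵛ {suc m}) ≢ 0ℤ
  |1|≢0 eq with trans (sym (norm-1 (suc m))) eq
  ... | ()
  open Split (split Full-closed (standardFrame (suc m)) 1ᵛ tt |1|≢0)

-- Designs as linear maps.

mulV : ∀ {v} → Matrix v → Vector v → Vector v
mulV M x i = dot (M i) x

mulV-· : ∀ {v} (A B : Matrix v) x i → mulV (A · B) x i ≡ mulV A (mulV B x) i
mulV-· A B x i = begin
  sumFin (λ j → sumFin (λ l → A i l * B l j) * x j)
    ≡⟨ sumFin-cong (λ j → trans (ℤ.*-comm _ (x j)) (sym (sumFin-*ˡ (x j) (λ l → A i l * B l j)))) ⟩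
  sumFin (λ j → sumFin (λ l → x j * (A i l * B l j)))
    ≡⟨ sumFin-swap (λ j l → x j * (A i l * B l j)) ⟩
  sumFin (λ l → sumFin (λ j → x j * (A i l * B l j)))
    ≡⟨ sumFin-cong (λ l → trans (sumFin-cong λ j → rotate (x j) (A i l) (B l j)) (sumFin-*ˡ (A i l) (λ j → B l j * x j))) ⟩
  sumFin (λ l → A i l * sumFin (λ j → B l j * x j)) ∎
  where
  open ≡-Reasoning
  rotate : ∀ x a b → x * (a * b) ≡ a * (b * x)
  rotate = solve-∀

adjoint : ∀ {v} (M : Matrix v) x y → dot (mulV M x) y ≡ dot x (mulV (transpose M) y)
adjoint M x y = begin
  sumFin (λ i → sumFin (λ j → M i j * x j) * y i)
    ≡⟨ sumFin-cong (λ i → trans (ℤ.*-comm _ (y i)) (sym (sumFin-*ˡ (y i) (λ j → M i j * x j)))) ⟩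
  sumFin (λ i → sumFin (λ j → y i * (M i j * x j)))
    ≡⟨ sumFin-swap (λ i j → y i * (M i j * x j)) ⟩
  sumFin (λ j → sumFin (λ i → y i * (M i j * x j)))
    ≡⟨ sumFin-cong (λ j → trans (sumFin-cong λ i → rotate (y i) (M i j) (x j)) (sumFin-*ˡ (x j) (λ i → M i j * y i))) ⟩
  sumFin (λ j → x j * sumFin (λ i → M i j * y i)) ∎
  where
  open ≡-Reasoning
  rotate : ∀ y m x → y * (m * x) ≡ x * (m * y)
  rotate = solve-∀

mulV-designGram : ∀ {v} k l (y : Vector v) i → mulV (designGram k l) y i ≡ (k - l) * y i + l * sumFin y
mulV-designGram k l y i = begin
  dot (lin (k - l) (I i) l 1ᵛ) y             ≡⟨ dot-linˡ (k - l) (I i) l 1ᵛ y ⟩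
  (k - l) * dot (I i) y + l * dot 1ᵛ y       ≡⟨ cong₂ (λ s t → (k - l) * s + l * t) (dot-I i y) (dot-1ˡ y) ⟩
  (k - l) * y i + l * sumFin y               ∎
  where open ≡-Reasoning

transpose-design : ∀ {v k l} {M : Matrix v} → IsSymmetricDesign v k l M → IsSymmetricDesign v k l (transpose M)
transpose-design D = record
  { zero-one = λ i j → zero-one j i
  ; row-sum  = col-sum
  ; col-sum  = row-sum
  ; MMᵀ      = MᵀM
  ; MᵀM      = MMᵀ
  }
  where open IsSymmetricDesign D

module _ {v k l} {M : Matrix v} (D : IsSymmetricDesign v k l M) where
  open IsSymmetricDesign D

  dot-mulV : ∀ x y → dot (mulV M x) (mulV M y) ≡ (+ k - + l) * dot x y + + l * (sumFin x * sumFin y)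
  dot-mulV x y = begin
    dot (mulV M x) (mulV M y)                          ≡⟨ adjoint M x (mulV M y) ⟩
    dot x (mulV (transpose M) (mulV M y))
      ≡⟨ dot-cong {x = x} (λ _ → refl) (λ i → trans (sym (mulV-· (transpose M) M y i))
           (trans (dot-cong {y = y} (MᵀM i) (λ _ → refl)) (mulV-designGram (+ k) (+ l) y i))) ⟩
    dot x (λ i → (+ k - + l) * y i + + l * sumFin y)   ≡⟨ sumFin-cong (λ i → expand′ (+ k - + l) (+ l) (x i) (y i) (sumFin y)) ⟩
    sumFin (λ i → (+ k - + l) * (x i * y i) + (+ l * sumFin y) * x i)
      ≡⟨ sumFin-linear (+ k - + l) (λ i → x i * y i) (+ l * sumFin y) x ⟩
    (+ k - + l) * dot x y + (+ l * sumFin y) * sumFin x ≡⟨ cong (λ t → (+ k - + l) * dot x y + t) (reorder (+ l) (sumFin y) (sumFin x)) ⟩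
    (+ k - + l) * dot x y + + l * (sumFin x * sumFin y) ∎
    where
    open ≡-Reasoning
    expand′ : ∀ n l x y s → x * (n * y + l * s) ≡ n * (x * y) + (l * s) * x
    expand′ = solve-∀
    reorder : ∀ l s t → l * s * t ≡ l * (t * s)
    reorder = solve-∀

  -- J annihilates the sum-zero hyperplane, so there a design acts as a similitude of factor k - λ.
  dot-mulV-sumZero : ∀ {x} → SumZero x → ∀ y → dot (mulV M x) (mulV M y) ≡ (+ k - + l) * dot x y
  dot-mulV-sumZero {x} x∈ y = begin
    dot (mulV M x) (mulV M y)                           ≡⟨ dot-mulV x y ⟩
    (+ k - + l) * dot x y + + l * (sumFin x * sumFin y) ≡⟨ cong (λ t → (+ k - + l) * dot x y + + l * (t * sumFin y)) (sum-zero {x = x} x∈) ⟩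
    (+ k - + l) * dot x y + + l * (0ℤ * sumFin y)       ≡⟨ drop ((+ k - + l) * dot x y) (+ l) (sumFin y) ⟩
    (+ k - + l) * dot x y                               ∎
    where
    open ≡-Reasoning
    drop : ∀ a l s → a + l * (0ℤ * s) ≡ a
    drop = solve-∀

  sum-mulV : ∀ x → sumFin (mulV M x) ≡ + k * sumFin x
  sum-mulV x = begin
    sumFin (mulV M x)                      ≡⟨ dot-1ˡ (mulV M x) ⟨
    dot 1ᵛ (mulV M x)                      ≡⟨ dot-comm 1ᵛ (mulV M x) ⟩
    dot (mulV M x) 1ᵛ                      ≡⟨ adjoint M x 1ᵛ ⟩
    dot x (mulV (transpose M) 1ᵛ)
      ≡⟨ sumFin-cong (λ j → trans (cong (x j *_) (trans (sumFin-cong (λ i → ℤ.*-identityʳ (M i j))) (col-sum j))) (ℤ.*-comm (x j) (+ k))) ⟩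
    sumFin (λ j → + k * x j)               ≡⟨ sumFin-*ˡ (+ k) x ⟩
    + k * sumFin x                         ∎
    where open ≡-Reasoning

  mulV-sumZero : ∀ {x} → SumZero x → SumZero (mulV M x)
  mulV-sumZero {x} x∈ = tt , trans (dot-1ˡ (mulV M x))
    (trans (sum-mulV x) (trans (cong (+ k *_) (sum-zero {x = x} x∈)) (ℤ.*-zeroʳ (+ k))))

  -- The classical identity k(k - 1) = λ(v - 1): the norm of M1 is v k² by row sums, is also given
  -- by the Gram matrix, and the common factor v cancels.
  design-equation : v ≢ 0 → + k * + k ≡ (+ k - + l) + + l * + v
  design-equation v≢0 = ℤ.i-j≡0⇒i≡j _ _ (cancel-≡0 {+ v} (λ { refl → v≢0 refl })
    (trans (factor (+ v) (+ k) (+ k - + l) (+ l)) (ℤ.i≡j⇒i-j≡0 count)))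
    where
    mulV-1 : ∀ i → mulV M 1ᵛ i ≡ + k
    mulV-1 i = trans (sumFin-cong λ j → ℤ.*-identityʳ (M i j)) (row-sum i)
    sum-1 : sumFin (1ᵛ {v}) ≡ + v
    sum-1 = trans (sym (dot-1ˡ (1ᵛ {v}))) (norm-1 v)
    count : + v * (+ k * + k) ≡ (+ k - + l) * + v + + l * (+ v * + v)
    count = trans (sym (sumFin-const v (+ k * + k)))
      (trans (sym (dot-cong mulV-1 mulV-1))
        (trans (dot-mulV 1ᵛ 1ᵛ) (cong₂ (λ s t → (+ k - + l) * s + + l * (t * t)) (norm-1 v) sum-1)))
    factor : ∀ v k n l → v * (k * k - (n + l * v)) ≡ v * (k * k) - (n * v + l * (v * v))
    factor = solve-∀

-- Here p = Nx·y, q = x·Ny and d = x·y. The hypothesis says N + Nᵀ = -c, which turns S = 2N + c into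
-- N - Nᵀ.
skew-step : ∀ c p q d → p + q ≡ - c * d → + 2 * p + c * d ≡ - (+ 2 * q + c * d)
skew-step c p q d eq = begin
  + 2 * p + c * d                                     ≡⟨ isolate c p q d ⟩
  + 2 * (p + q) + + 2 * (c * d) - (+ 2 * q + c * d)
    ≡⟨ cong (λ t → + 2 * t + + 2 * (c * d) - (+ 2 * q + c * d)) eq ⟩
  + 2 * (- c * d) + + 2 * (c * d) - (+ 2 * q + c * d) ≡⟨ cancel c q d ⟩
  - (+ 2 * q + c * d)                                 ∎
  where
  open ≡-Reasoning
  isolate : ∀ c p q d → + 2 * p + c * d ≡ + 2 * (p + q) + + 2 * (c * d) - (+ 2 * q + c * d)
  isolate = solve-∀
  cancel : ∀ c q d → + 2 * (- c * d) + + 2 * (c * d) - (+ 2 * q + c * d) ≡ - (+ 2 * q + c * d)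
  cancel = solve-∀

-- In the same notation, with a = Nx·Ny: SᵀS = 4NᵀN + 2c(N + Nᵀ) + c² = 4n₁n₂ - 2c² + c².
similitude-step : ∀ n₁ n₂ c a p q d → a ≡ n₁ * (n₂ * d) → p + q ≡ - c * d →
                  + 2 * (+ 2 * a + c * p) + c * (+ 2 * q + c * d) ≡ (+ 4 * n₁ * n₂ - c * c) * d
similitude-step n₁ n₂ c a p q d refl eq = begin
  + 2 * (+ 2 * a + c * p) + c * (+ 2 * q + c * d)       ≡⟨ regroup c a p q d ⟩
  + 4 * a + + 2 * c * (p + q) + c * c * d               ≡⟨ cong (λ t → + 4 * a + + 2 * c * t + c * c * d) eq ⟩
  + 4 * a + + 2 * c * (- c * d) + c * c * d             ≡⟨ collect n₁ n₂ c d ⟩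
  (+ 4 * n₁ * n₂ - c * c) * d                           ∎
  where
  open ≡-Reasoning
  regroup : ∀ c a p q d → + 2 * (+ 2 * a + c * p) + c * (+ 2 * q + c * d) ≡ + 4 * a + + 2 * c * (p + q) + c * c * d
  regroup = solve-∀
  collect : ∀ n₁ n₂ c d → + 4 * (n₁ * (n₂ * d)) + + 2 * c * (- c * d) + c * c * d ≡ (+ 4 * n₁ * n₂ - c * c) * d
  collect = solve-∀

-- A design that is the sum of two designs.

module Decomposition {v k l k₁ l₁ k₂ l₂} {M M₁ M₂ : Matrix v}
  (D : IsSymmetricDesign v k l M) (D₁ : IsSymmetricDesign v k₁ l₁ M₁) (D₂ : IsSymmetricDesign v k₂ l₂ M₂)
  (M≡M₁+M₂ : ∀ i j → M i j ≡ M₁ i j + M₂ i j) (i₀ : Fin v) where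

  n₁ n₂ c e σ : ℤ
  n₁ = + k₁ - + l₁
  n₂ = + k₂ - + l₂
  c = + l - + l₁ - + l₂
  e = + 4 * n₁ * n₂ - c * c
  σ = n₁ * n₂ - c + 1ℤ

  4σ : + 4 * σ ≡ e + (c - + 2) * (c - + 2)
  4σ = complete n₁ n₂ c
    where
    complete : ∀ n₁ n₂ c → + 4 * (n₁ * n₂ - c + 1ℤ) ≡ + 4 * n₁ * n₂ - c * c + (c - + 2) * (c - + 2)
    complete = solve-∀

  k≡k₁+k₂ : + k ≡ + k₁ + + k₂
  k≡k₁+k₂ = begin
    + k                                     ≡⟨ row-sum D i₀ ⟨
    sumFin (M i₀)                          ≡⟨ sumFin-cong (M≡M₁+M₂ i₀) ⟩
    sumFin (λ j → M₁ i₀ j + M₂ i₀ j)      ≡⟨ sumFin-+ (M₁ i₀) (M₂ i₀) ⟩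
    sumFin (M₁ i₀) + sumFin (M₂ i₀)       ≡⟨ cong₂ _+_ (row-sum D₁ i₀) (row-sum D₂ i₀) ⟩
    + k₁ + + k₂                             ∎
    where
    open ≡-Reasoning
    open IsSymmetricDesign

  -- Expand k² = (k₁ + k₂)² and replace each of the three squares by its design equation. Hence the
  -- fraction in σ is the integer `c`.
  2k₁k₂ : + 2 * + k₁ * + k₂ ≡ c * (+ v - 1ℤ)
  2k₁k₂ = begin
    + 2 * + k₁ * + k₂
      ≡⟨ square (+ k₁) (+ k₂) ⟩
    (+ k₁ + + k₂) * (+ k₁ + + k₂) - + k₁ * + k₁ - + k₂ * + k₂
      ≡⟨ cong (λ t → t * t - + k₁ * + k₁ - + k₂ * + k₂) k≡k₁+k₂ ⟨
    + k * + k - + k₁ * + k₁ - + k₂ * + k₂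
      ≡⟨ cong₂ _-_ (cong₂ _-_ (design-equation D v≢0) (design-equation D₁ v≢0)) (design-equation D₂ v≢0) ⟩
    + k - + l + + l * + v - (n₁ + + l₁ * + v) - (n₂ + + l₂ * + v)
      ≡⟨ cong (λ t → t - + l + + l * + v - (n₁ + + l₁ * + v) - (n₂ + + l₂ * + v)) k≡k₁+k₂ ⟩
    + k₁ + + k₂ - + l + + l * + v - (n₁ + + l₁ * + v) - (n₂ + + l₂ * + v)
      ≡⟨ collect (+ k₁) (+ k₂) (+ l) (+ l₁) (+ l₂) (+ v) ⟩
    c * (+ v - 1ℤ) ∎
    where
    open ≡-Reasoning
    v≢0 : v ≢ 0
    v≢0 v≡0 = ¬Fin0 (subst Fin v≡0 i₀)
    square : ∀ a b → + 2 * a * b ≡ (a + b) * (a + b) - a * a - b * b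
    square = solve-∀
    collect : ∀ k₁ k₂ l l₁ l₂ v → k₁ + k₂ - l + l * v - (k₁ - l₁ + l₁ * v) - (k₂ - l₂ + l₂ * v)
                                ≡ (l - l₁ - l₂) * (v - 1ℤ)
    collect = solve-∀

  M₁ᵀ M₂ᵀ : Matrix v
  M₁ᵀ = transpose M₁
  M₂ᵀ = transpose M₂

  N S : Vector v → Vector v
  N x = mulV M₁ (mulV M₂ᵀ x)
  S x = lin (+ 2) (N x) c x

  -- Since MMᵀ = M₁M₁ᵀ + M₂M₂ᵀ + N + Nᵀ and on the hyperplane the first three products are scalars,
  -- N + Nᵀ is (k - λ) - n₁ - n₂, which is -c because k = k₁ + k₂.
  N-symmetrized : ∀ {x} → SumZero x → ∀ y → dot (N x) y + dot x (N y) ≡ - c * dot x y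
  N-symmetrized {x} x∈ y = begin
    dot (N x) y + dot x (N y)
      ≡⟨ cong₂ _+_ (adjoint M₁ (mulV M₂ᵀ x) y)
           (trans (dot-comm x (N y)) (trans (adjoint M₁ (mulV M₂ᵀ y) x) (dot-comm (mulV M₂ᵀ y) (mulV M₁ᵀ x)))) ⟩
    dot x₂ y₁ + dot x₁ y₂
      ≡⟨ isolate (dot x₁ y₁) (dot x₁ y₂) (dot x₂ y₁) (dot x₂ y₂) ⟩
    (dot x₁ y₁ + dot x₁ y₂ + (dot x₂ y₁ + dot x₂ y₂)) - dot x₁ y₁ - dot x₂ y₂
      ≡⟨ cong (λ t → t - dot x₁ y₁ - dot x₂ y₂) split-dot ⟨
    dot (mulV (transpose M) x) (mulV (transpose M) y) - dot x₁ y₁ - dot x₂ y₂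
      ≡⟨ cong₂ _-_ (cong₂ _-_ (dot-mulV-sumZero (transpose-design D) x∈ y) (dot-mulV-sumZero (transpose-design D₁) x∈ y))
                   (dot-mulV-sumZero (transpose-design D₂) x∈ y) ⟩
    (+ k - + l) * dot x y - n₁ * dot x y - n₂ * dot x y
      ≡⟨ cong (λ t → (t - + l) * dot x y - n₁ * dot x y - n₂ * dot x y) k≡k₁+k₂ ⟩
    (+ k₁ + + k₂ - + l) * dot x y - n₁ * dot x y - n₂ * dot x y
      ≡⟨ collect (+ k₁) (+ k₂) (+ l) (+ l₁) (+ l₂) (dot x y) ⟩
    - c * dot x y ∎
    where
    open ≡-Reasoning
    x₁ x₂ y₁ y₂ : Vector v
    x₁ = mulV M₁ᵀ x
    x₂ = mulV M₂ᵀ x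
    y₁ = mulV M₁ᵀ y
    y₂ = mulV M₂ᵀ y
    mulV-+ : ∀ z i → mulV (transpose M) z i ≡ mulV M₁ᵀ z i + mulV M₂ᵀ z i
    mulV-+ z i = trans (sumFin-cong λ j → trans (cong (_* z j) (M≡M₁+M₂ j i)) (ℤ.*-distribʳ-+ (z j) (M₁ j i) (M₂ j i)))
                       (sumFin-+ (λ j → M₁ j i * z j) (λ j → M₂ j i * z j))
    dot-+ˡ : ∀ (a b z : Vector v) → dot (λ i → a i + b i) z ≡ dot a z + dot b z
    dot-+ˡ a b z = trans (sumFin-cong λ i → ℤ.*-distribʳ-+ (z i) (a i) (b i)) (sumFin-+ (λ i → a i * z i) (λ i → b i * z i))
    dot-+ʳ : ∀ (z a b : Vector v) → dot z (λ i → a i + b i) ≡ dot z a + dot z b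
    dot-+ʳ z a b = trans (sumFin-cong λ i → ℤ.*-distribˡ-+ (z i) (a i) (b i)) (sumFin-+ (λ i → z i * a i) (λ i → z i * b i))
    split-dot : dot (mulV (transpose M) x) (mulV (transpose M) y) ≡ dot x₁ y₁ + dot x₁ y₂ + (dot x₂ y₁ + dot x₂ y₂)
    split-dot = trans (dot-cong (mulV-+ x) (mulV-+ y))
      (trans (dot-+ˡ x₁ x₂ (λ i → y₁ i + y₂ i)) (cong₂ _+_ (dot-+ʳ x₁ y₁ y₂) (dot-+ʳ x₂ y₁ y₂)))
    isolate : ∀ p q r s → r + q ≡ (p + q + (r + s)) - p - s
    isolate = solve-∀
    collect : ∀ k₁ k₂ l l₁ l₂ d → (k₁ + k₂ - l) * d - (k₁ - l₁) * d - (k₂ - l₂) * d ≡ - (l - l₁ - l₂) * d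
    collect = solve-∀

  N∈ : ∀ {x} → SumZero x → SumZero (N x)
  N∈ x∈ = mulV-sumZero D₁ (mulV-sumZero (transpose-design D₂) x∈)

  dot-N : ∀ {x} → SumZero x → ∀ y → dot (N x) (N y) ≡ n₁ * (n₂ * dot x y)
  dot-N {x} x∈ y = trans (dot-mulV-sumZero D₁ (mulV-sumZero (transpose-design D₂) x∈) (mulV M₂ᵀ y))
                         (cong (n₁ *_) (dot-mulV-sumZero (transpose-design D₂) x∈ y))

  S-preserves : ∀ {x} → SumZero x → SumZero (S x)
  S-preserves {x} x∈ = ∩⟂-closed Full-closed 1ᵛ .lin∈ (+ 2) {N x} c {x} (N∈ {x} x∈) x∈

  S-skew : ∀ {x} → SumZero x → ∀ y → dot (S x) y ≡ - dot x (S y)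
  S-skew {x} x∈ y =
        trans (dot-linˡ (+ 2) (N x) c x y)
          (trans (skew-step c (dot (N x) y) (dot x (N y)) (dot x y) (N-symmetrized {x} x∈ y))
                 (cong -_ (sym (dot-linʳ (+ 2) (N y) c y x))))

  S-scales : ∀ {x} → SumZero x → ∀ y → dot (S x) (S y) ≡ e * dot x y
  S-scales {x} x∈ y =
        trans (dot-linˡ (+ 2) (N x) c x (S y))
          (trans (cong₂ (λ s t → + 2 * s + c * t) (dot-linʳ (+ 2) (N y) c y (N x)) (dot-linʳ (+ 2) (N y) c y x))
            (similitude-step n₁ n₂ c (dot (N x) (N y)) (dot (N x) y) (dot x (N y)) (dot x y)
              (dot-N {x} x∈ y) (N-symmetrized {x} x∈ y)))

  S-similitude : SkewSimilitude SumZero S e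
  S-similitude = record
    { closed     = ∩⟂-closed Full-closed 1ᵛ
    ; preserves  = λ {x} → S-preserves {x}
    ; skew       = λ {x} {y} x∈ _ → S-skew {x} x∈ y
    ; similitude = λ {x} {y} x∈ _ → S-scales {x} x∈ y
    }

square-class : ∀ {m S e} → SkewSimilitude (SumZero {suc m}) S e → e ≢ 0ℤ →
               ∃ λ h → m ≡ 2 ℕ.* h × 1ℤ ~ + suc m * e ^ h
square-class {m} {S} {e} 𝓢 e≢0 = combine (gram-skew {P = SumZero} {S} {e} 𝓢 e≢0 (proj₁ (proj₂ (sumZeroFrame m))))
  where
  bs = proj₁ (sumZeroFrame m)
  combine : (∃ λ h → m ≡ 2 ℕ.* h × gramProduct bs ~ e ^ h) → ∃ λ h → m ≡ 2 ℕ.* h × 1ℤ ~ + suc m * e ^ h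
  combine (h , eq , g) = h , eq ,
    ~-trans {b = + suc m * gramProduct bs} (proj₂ (proj₂ (sumZeroFrame m))) (~-*ˡ (+ suc m) {gramProduct bs} {e ^ h} g)

-- Integer Hilbert symbols

∣-lin : ∀ d a {x} b {y} → d ∣ x → d ∣ y → d ∣ (a * x + b * y)
∣-lin d a {x} b {y} d∣x d∣y =
  ∣⇒∣ᵤ (Signed.∣m∣n⇒∣m+n (Signed.∣n⇒∣m*n a (∣ᵤ⇒∣ {d} {x} d∣x)) (Signed.∣n⇒∣m*n b (∣ᵤ⇒∣ {d} {y} d∣y)))

∣-*ˡ : ∀ d a {x} → d ∣ x → d ∣ (a * x)
∣-*ˡ d a {x} d∣x = ∣⇒∣ᵤ (Signed.∣n⇒∣m*n a (∣ᵤ⇒∣ {d} {x} d∣x))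

constₚ : ∀ {p} → ℤ → ℤₚ p
constₚ a .res _    = a
constₚ {p} a .compat n = subst (+ (p ℕ.^ n) ∣_) (sym (ℤ.i≡j⇒i-j≡0 {a} refl)) ((p ℕ.^ n) ℕ.∣0)

linₚ : ∀ {p} → ℤ → ℤₚ p → ℤ → ℤₚ p → ℤₚ p
linₚ a x b y .res n    = a * res x n + b * res y n
linₚ {p} a x b y .compat n =
  subst (+ (p ℕ.^ n) ∣_) (regroup a b (res x (suc n)) (res x n) (res y (suc n)) (res y n))
        (∣-lin (+ (p ℕ.^ n)) a b (compat x n) (compat y n))
  where
  regroup : ∀ a b x′ x y′ y → a * (x′ - x) + b * (y′ - y) ≡ a * x′ + b * y′ - (a * x + b * y)
  regroup = solve-∀

scaleₚ : ∀ {p} → ℤ → ℤₚ p → ℤₚ p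
scaleₚ a x .res n    = a * res x n
scaleₚ {p} a x .compat n =
  subst (+ (p ℕ.^ n) ∣_) (distrib a (res x (suc n)) (res x n)) (∣-*ˡ (+ (p ℕ.^ n)) a (compat x n))
  where
  distrib : ∀ a x′ x → a * (x′ - x) ≡ a * x′ - a * x
  distrib = solve-∀

res-coherent : ∀ {p} (x : ℤₚ p) m n → + (p ℕ.^ n) ∣ (res x (m ℕ.+ n) - res x n)
res-coherent {p} x zero    n = subst (+ (p ℕ.^ n) ∣_) (sym (ℤ.i≡j⇒i-j≡0 {res x n} refl)) ((p ℕ.^ n) ℕ.∣0)
res-coherent {p} x (suc m) n =
  subst (+ (p ℕ.^ n) ∣_) (telescope (res x (suc m ℕ.+ n)) (res x (m ℕ.+ n)) (res x n))
    (∣-lin (+ (p ℕ.^ n)) 1ℤ {res x (suc m ℕ.+ n) - res x (m ℕ.+ n)} 1ℤ {res x (m ℕ.+ n) - res x n}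
      (ℕ.∣-trans (ℕ.divides (p ℕ.^ m) (ℕ.^-distribˡ-+-* p m n)) (compat x (m ℕ.+ n))) (res-coherent x m n))
  where
  telescope : ∀ a b c → 1ℤ * (a - b) + 1ℤ * (b - c) ≡ a - c
  telescope = solve-∀

module _ {p} (p-prime : Prime p) where

  private instance
    p-nonZero    = prime⇒nonZero p-prime
    p-nonTrivial = prime⇒nonTrivial p-prime

  -- A form of the additivity of the `p`-adic valuation; each `p` is cancelled from a factor that it
  -- divides.
  prime-power-∣* : ∀ m n a b → p ℕ.^ (m ℕ.+ n) ℕ.∣ a ℕ.* b → p ℕ.^ m ℕ.∣ a ⊎ p ℕ.^ n ℕ.∣ b
  prime-power-∣* zero    n       a b _ = inj₁ (ℕ.1∣ a)
  prime-power-∣* (suc m) zero    a b _ = inj₂ (ℕ.1∣ b)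
  prime-power-∣* (suc m) (suc n) a b p^∣ab
    with euclidsLemma a b p-prime (ℕ.∣-trans (ℕ.m∣m*n (p ℕ.^ (m ℕ.+ suc n))) p^∣ab)
  ... | inj₁ (ℕ.divides a′ refl) =
    map (λ d → subst (p ℕ.^ suc m ℕ.∣_) (ℕ.*-comm p a′) (ℕ.*-monoʳ-∣ p d)) (λ d → d)
        (prime-power-∣* m (suc n) a′ b (ℕ.*-cancelˡ-∣ p (subst (p ℕ.^ suc (m ℕ.+ suc n) ℕ.∣_) (move p a′ b) p^∣ab)))
    where
    move : ∀ p a b → a ℕ.* p ℕ.* b ≡ p ℕ.* (a ℕ.* b)
    move = ℕ.solve-∀
  ... | inj₂ (ℕ.divides b′ refl) =
    map (λ d → d) (λ d → subst (p ℕ.^ suc n ℕ.∣_) (ℕ.*-comm p b′) (ℕ.*-monoʳ-∣ p d))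
        (prime-power-∣* (suc m) n a b′ (ℕ.*-cancelˡ-∣ p
          (subst₂ (λ i j → p ℕ.^ i ℕ.∣ j) (cong suc (ℕ.+-suc m n)) (move p a b′) p^∣ab)))
    where
    move : ∀ p a b → a ℕ.* (b ℕ.* p) ≡ p ℕ.* (a ℕ.* b)
    move = ℕ.solve-∀

  n<p^n : ∀ n → n ℕ.< p ℕ.^ n
  n<p^n zero    = ℕ.s≤s ℕ.z≤n
  n<p^n (suc n) = ℕ.<-≤-trans (ℕ.s≤s (n<p^n n))
    (ℕ.≤-trans (ℕ.≤-trans (ℕ.≤-reflexive (ℕ.+-comm 1 (p ℕ.^ n))) (ℕ.+-monoʳ-≤ (p ℕ.^ n) (ℕ.≤-trans (ℕ.m^n>0 p n) (ℕ.m≤m+n _ 0))))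
               (ℕ.*-monoˡ-≤ (p ℕ.^ n) (ℕ.nonTrivial⇒n>1 p)))

  -- Because |a| < p^|a|, the exponent |a| exceeds the valuation of `a`, which therefore need not be
  -- computed.
  p^∤ : ∀ {a} → a ≢ 0ℤ → ¬ (+ (p ℕ.^ ℤ.∣ a ∣) ∣ a)
  p^∤ {a} a≢0 d = ℕ.<⇒≱ (n<p^n ℤ.∣ a ∣) (ℕ.∣⇒≤ {{ℕ.≢-nonZero (a≢0 ∘ ℤ.∣i∣≡0⇒i≡0)}} d)

  constₚ-nonZero : ∀ {a} → a ≢ 0ℤ → NonZeroₚ (constₚ {p} a)
  constₚ-nonZero {a} a≢0 = ℤ.∣ a ∣ , p^∤ a≢0

  scaleₚ-nonZero : ∀ {a} → a ≢ 0ℤ → ∀ x → NonZeroₚ x → NonZeroₚ (scaleₚ {p} a x)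
  -- Valuations add: `a` is not divisible by p^m, and by coherence the residue of `x` at level m + n
  -- is still not divisible by p^n.
  scaleₚ-nonZero {a} a≢0 x (n , p^n∤x) = m ℕ.+ n , λ d →
    refute (prime-power-∣* m n ℤ.∣ a ∣ ℤ.∣ res x (m ℕ.+ n) ∣
      (subst (p ℕ.^ (m ℕ.+ n) ℕ.∣_) (ℤ.abs-* a (res x (m ℕ.+ n))) d))
    where
    m = ℤ.∣ a ∣
    difference : ∀ s t → 1ℤ * s + -1ℤ * (s - t) ≡ t
    difference = solve-∀
    refute : ¬ (p ℕ.^ m ℕ.∣ ℤ.∣ a ∣ ⊎ p ℕ.^ n ℕ.∣ ℤ.∣ res x (m ℕ.+ n) ∣)
    refute (inj₁ d) = p^∤ a≢0 d
    refute (inj₂ d) = p^n∤x (subst (+ (p ℕ.^ n) ∣_) (difference (res x (m ℕ.+ n)) (res x n))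
      (∣-lin (+ (p ℕ.^ n)) 1ℤ {res x (m ℕ.+ n)} -1ℤ d (res-coherent x m n)))

  ¬nonZeroₚ⇒∣ : ∀ (x : ℤₚ p) → ¬ NonZeroₚ x → ∀ n → + (p ℕ.^ n) ∣ res x n
  ¬nonZeroₚ⇒∣ x ¬nz n = decidable-stable (_ ℕ.∣? _) (λ ∤ → ¬nz (n , ∤))

Solvable : ℕ → ℤ → ℤ → Set
Solvable p a b = Σ (ℤₚ p) λ x → Σ (ℤₚ p) λ y → Σ (ℤₚ p) λ z →
  (NonZeroₚ x ⊎ NonZeroₚ y ⊎ NonZeroₚ z) × SolvesₚEq a b 1ℤ x y z

-- The fraction a/1 already in lowest terms. `ℤtoℚ` normalises by a gcd, which does not compute for
-- a variable `a`.
ι : ℤ → ℚ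
ι a = mkℚ a 0 (λ (_ , d∣1) → ℕ.∣1⇒≡1 d∣1)

ℤtoℚ≡ι : ∀ a → ℤtoℚ a ≡ ι a
ℤtoℚ≡ι a = ℚ.↥p/↧p≡p (ι a)

↥-ℤtoℚ : ∀ a → ↥ (ℤtoℚ a) ≡ a
↥-ℤtoℚ a = cong ↥_ (ℤtoℚ≡ι a)

↧-ℤtoℚ : ∀ a → ↧ (ℤtoℚ a) ≡ 1ℤ
↧-ℤtoℚ a = cong ↧_ (ℤtoℚ≡ι a)

module _ {p : ℕ} (a b : ℤ) where
  private
    coeff-a : ↥ (ℤtoℚ a) * ↧ (ℤtoℚ b) ≡ a
    coeff-a = trans (cong₂ _*_ (↥-ℤtoℚ a) (↧-ℤtoℚ b)) (ℤ.*-identityʳ a)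
    coeff-b : ↥ (ℤtoℚ b) * ↧ (ℤtoℚ a) ≡ b
    coeff-b = trans (cong₂ _*_ (↥-ℤtoℚ b) (↧-ℤtoℚ a)) (ℤ.*-identityʳ b)
    coeff-1 : ↧ (ℤtoℚ a) * ↧ (ℤtoℚ b) ≡ 1ℤ
    coeff-1 = cong₂ _*_ (↧-ℤtoℚ a) (↧-ℤtoℚ b)
    SolvesEq : ℤₚ p → ℤₚ p → ℤₚ p → ℤ → ℤ → ℤ → Set
    SolvesEq x y z a b c = SolvesₚEq a b c x y z

  toSolvable : HilbertSolvable p (ℤtoℚ a) (ℤtoℚ b) → Solvable p a b
  toSolvable (x , y , z , nz , eq) = x , y , z , nz ,
    subst (SolvesEq x y z a b) coeff-1 (subst₂ (λ A B → SolvesEq x y z A B (↧ (ℤtoℚ a) * ↧ (ℤtoℚ b))) coeff-a coeff-b eq)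

  fromSolvable : Solvable p a b → HilbertSolvable p (ℤtoℚ a) (ℤtoℚ b)
  fromSolvable (x , y , z , nz , eq) = x , y , z , nz ,
    subst₂ (λ A B → SolvesEq x y z A B (↧ (ℤtoℚ a) * ↧ (ℤtoℚ b))) (sym coeff-a) (sym coeff-b) (subst (SolvesEq x y z a b) (sym coeff-1) eq)

record GlobalSolution (a b : ℤ) : Set where
  field
    x y z      : ℤ
    nontrivial : x ≢ 0ℤ ⊎ y ≢ 0ℤ ⊎ z ≢ 0ℤ
    equation   : a * (x * x) + b * (y * y) ≡ z * z

global⇒local : ∀ {p a b} → Prime p → GlobalSolution a b → Solvable p a b
global⇒local {p} {a} {b} p-prime G = constₚ x , constₚ y , constₚ z ,
  map (constₚ-nonZero p-prime) (map (constₚ-nonZero p-prime) (constₚ-nonZero p-prime)) nontrivial ,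
  λ n → subst (+ (p ℕ.^ n) ∣_) (sym (ℤ.i≡j⇒i-j≡0 {a * (x * x) + b * (y * y)} (trans equation (sym (ℤ.*-identityˡ (z * z))))))
              ((p ℕ.^ n) ℕ.∣0)
  where open GlobalSolution G

-- A solution of σx² − vy² = z² with y ≠ 0 exhibits −v as a norm from ℚ(√σ). Since −σ is a norm as well,
-- multiplying by it shows that b is a local norm iff b′ is, whenever b b′ = σ v.
module NormTransfer {p} (p-prime : Prime p) {σ v} (G : GlobalSolution σ (- v)) where
  open GlobalSolution G

  private
    R : ℤ
    R = σ * (x * x) + - v * (y * y) - z * z

    R≡0 : R ≡ 0ℤ
    R≡0 = ℤ.i≡j⇒i-j≡0 equation

  -- With y = 0 the global solution makes σ a rational square, so (x, 0, z) works for every second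
  -- argument.
  isotropic : y ≡ 0ℤ → ∀ b → Solvable p σ b
  isotropic y≡0 b = global⇒local {a = σ} {b} p-prime record
    { x = x ; y = 0ℤ ; z = z
    ; nontrivial = map (λ x≢0 → x≢0) (λ { (inj₁ y≢0) → contradiction y≡0 y≢0 ; (inj₂ z≢0) → inj₂ z≢0 }) nontrivial
    ; equation   = trans (drop-b σ b (- v) x) (trans (cong (λ t → σ * (x * x) + - v * (t * t)) (sym y≡0)) equation)
    }
    where
    drop-b : ∀ σ b c x → σ * (x * x) + b * (0ℤ * 0ℤ) ≡ σ * (x * x) + c * (0ℤ * 0ℤ)
    drop-b = solve-∀

  vanishing : ∀ {b} b′ → ((X , Y , Z , _) : Solvable p σ b) → ¬ NonZeroₚ Y → Solvable p σ b′
  vanishing {b} b′ (X , Y , Z , nz , eq) ¬nzY = X , Y , Z , nz , λ n →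
    subst (+ (p ℕ.^ n) ∣_) (regroup σ b b′ (res X n) (res Y n) (res Z n))
      (∣-lin (+ (p ℕ.^ n)) 1ℤ {σ * (res X n * res X n) + b * (res Y n * res Y n) - 1ℤ * (res Z n * res Z n)}
             ((b′ - b) * res Y n) (eq n) (¬nonZeroₚ⇒∣ p-prime Y ¬nzY n))
    where
    regroup : ∀ σ b b′ X Y Z → 1ℤ * (σ * (X * X) + b * (Y * Y) - 1ℤ * (Z * Z)) + (b′ - b) * Y * Y
                              ≡ σ * (X * X) + b′ * (Y * Y) - 1ℤ * (Z * Z)
    regroup = solve-∀

  norm-product : ∀ {b b′} → b ≢ 0ℤ → b * b′ ≡ σ * v → y ≢ 0ℤ →
                 ((X , Y , Z , _) : Solvable p σ b) → NonZeroₚ Y → Solvable p σ b′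
  norm-product {b} {b′} b≢0 bb′≡σv y≢0 (X , Y , Z , _ , eq) nzY =
    -- These are the coefficients of √σ (z + x√σ)(Z + X√σ). Its three factors have norms -σ, -v y²
    -- and b Y², with product b′(b y Y)² because b b′ = σ v.
    linₚ (σ * x) X z Z , scaleₚ (b * y) Y , linₚ (σ * z) X (σ * x) Z ,
    inj₂ (inj₁ (scaleₚ-nonZero p-prime (≢0-* b≢0 y≢0) Y nzY)) , λ n →
    subst (+ (p ℕ.^ n) ∣_)
      (trans (cong (λ t → σ * v * (y * y) * Q n + t)
               (sym (lin-zeros (σ * (Q n - b * (res Y n * res Y n))) (b * (y * y) * (res Y n * res Y n))
                               R≡0 (ℤ.i≡j⇒i-j≡0 bb′≡σv))))
             (multiply σ v b b′ x y z (res X n) (res Y n) (res Z n)))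
      (subst (+ (p ℕ.^ n) ∣_) (sym (ℤ.+-identityʳ (σ * v * (y * y) * Q n)))
        (∣-*ˡ (+ (p ℕ.^ n)) (σ * v * (y * y)) {Q n} (eq n)))
    where
    Q : ℕ → ℤ
    Q n = σ * (res X n * res X n) + b * (res Y n * res Y n) - 1ℤ * (res Z n * res Z n)
    multiply : ∀ σ v b b′ x y z X Y Z →
      σ * v * (y * y) * (σ * (X * X) + b * (Y * Y) - 1ℤ * (Z * Z))
        + (σ * (σ * (X * X) + b * (Y * Y) - 1ℤ * (Z * Z) - b * (Y * Y)) * (σ * (x * x) + - v * (y * y) - z * z)
          + b * (y * y) * (Y * Y) * (b * b′ - σ * v))
      ≡ σ * ((σ * x * X + z * Z) * (σ * x * X + z * Z)) + b′ * ((b * y * Y) * (b * y * Y))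
        - 1ℤ * ((σ * z * X + σ * x * Z) * (σ * z * X + σ * x * Z))
    multiply = solve-∀

  -- Whether `Y` vanishes cannot be decided, but both cases yield a solution, so the double negation
  -- holds. It suffices for ruling out two different symbol values.
  transfer : ∀ {b b′} → b ≢ 0ℤ → b * b′ ≡ σ * v → Solvable p σ b → ¬ ¬ Solvable p σ b′
  transfer {b} {b′} b≢0 bb′≡σv s ¬b′ with y ℤ.≟ 0ℤ
  ... | yes y≡0 = ¬b′ (isotropic y≡0 b′)
  ... | no  y≢0 = ¬b′ (vanishing {b} b′ s (¬b′ ∘ norm-product {b} {b′} b≢0 bb′≡σv y≢0 s))

-- Parities, signs and halves.

choose-2-double : ∀ h → ∃ λ j → (h ℕ.* 2) C 2 ≡ h ℕ.+ j ℕ.* 2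
choose-2-double zero    = 0 , refl
choose-2-double (suc h) with choose-2-double h
-- Since (2h choose 2) = h(2h - 1), the witness `j` is h(h - 1), which grows by 2h from h to h + 1.
... | j , eq = h ℕ.* 2 ℕ.+ j , (begin
  (2 ℕ.+ n) C 2                   ≡⟨ nCk+nC[k+1]≡[n+1]C[k+1] (1 ℕ.+ n) 1 ⟨
  (1 ℕ.+ n) C 1 ℕ.+ (1 ℕ.+ n) C 2
    ≡⟨ cong₂ ℕ._+_ (nC1≡n (1 ℕ.+ n)) (sym (nCk+nC[k+1]≡[n+1]C[k+1] n 1)) ⟩
  1 ℕ.+ n ℕ.+ (n C 1 ℕ.+ n C 2)   ≡⟨ cong₂ (λ s t → 1 ℕ.+ n ℕ.+ (s ℕ.+ t)) (nC1≡n n) eq ⟩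
  1 ℕ.+ n ℕ.+ (n ℕ.+ (h ℕ.+ j ℕ.* 2)) ≡⟨ regroup h j ⟩
  suc h ℕ.+ (n ℕ.+ j) ℕ.* 2       ∎)
  where
  open ≡-Reasoning
  n = h ℕ.* 2
  regroup : ∀ h j → 1 ℕ.+ h ℕ.* 2 ℕ.+ (h ℕ.* 2 ℕ.+ (h ℕ.+ j ℕ.* 2)) ≡ 1 ℕ.+ h ℕ.+ (h ℕ.* 2 ℕ.+ j) ℕ.* 2
  regroup = ℕ.solve-∀

parity : ∀ h → ∃ λ k → h ≡ k ℕ.* 2 ⊎ h ≡ suc (k ℕ.* 2)
parity zero    = 0 , inj₁ refl
parity (suc h) with parity h
... | k , inj₁ eq = k , inj₂ (cong suc eq)
... | k , inj₂ eq = suc k , inj₁ (cong suc eq)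

^-double : ∀ i k → i ^ (k ℕ.* 2) ≡ i ^ k * i ^ k
^-double i k = trans (sym (ℤ.^-*-assoc i k 2)) (cong (i ^ k *_) (ℤ.*-identityʳ (i ^ k)))

involution-^-double : ∀ i → i * i ≡ 1ℤ → ∀ k → i ^ (k ℕ.* 2) ≡ 1ℤ
involution-^-double i ii≡1 zero    = refl
involution-^-double i ii≡1 (suc k) = trans (sym (ℤ.*-assoc i i _)) (cong₂ _*_ ii≡1 (involution-^-double i ii≡1 k))

involution-^-choose : ∀ i → i * i ≡ 1ℤ → ∀ h → i ^ ((h ℕ.* 2) C 2) ≡ i ^ h
involution-^-choose i ii≡1 h with choose-2-double h
... | j , eq = trans (cong (i ^_) eq) (trans (ℤ.^-distribˡ-+-* i h (j ℕ.* 2))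
  (trans (cong (i ^ h *_) (involution-^-double i ii≡1 j)) (ℤ.*-identityʳ (i ^ h))))

even-suc : ∀ h → suc (2 ℕ.* h) % 2 ≡ 1
even-suc h = trans (cong (λ t → suc t % 2) (ℕ.*-comm 2 h)) (ℕ.[m+kn]%n≡m%n 1 h 2)

odd-pred : ∀ m → suc m % 2 ≡ 1 → ∃ λ h → m ≡ h ℕ.* 2
odd-pred m odd = suc m / 2 ,
  ℕ.suc-injective (trans (ℕ.m≡m%n+[m/n]*n (suc m) 2) (cong (ℕ._+ (suc m / 2) ℕ.* 2) odd))

half-square : ∀ σ a → + 4 * σ ≡ a * a → ∃ λ z → σ ≡ z * z
half-square σ a eq with a ℤ.%ℕ 2 | a ℤ./ℕ 2 | ℤ.n%ℕd<d a 2 | ℤ.a≡a%ℕn+[a/ℕn]*n a 2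
... | 0 | q | _ | refl = q , ℤ.*-cancelˡ-≡ (+ 4) σ (q * q) (trans eq (double q))
  where
  double : ∀ q → (0ℤ + q * + 2) * (0ℤ + q * + 2) ≡ + 4 * (q * q)
  double = solve-∀
-- An odd a = 2q + 1 has a² = 4(q² + q) + 1, so 4σ = a² would give 4 ∣ 1.
... | 1 | q | _ | refl = contradiction (ℕ.∣1⇒≡1 4∣1) λ ()
  where
  odd-square : ∀ σ q → + 4 * (σ - q * q - q) ≡ + 4 * σ - (1ℤ + q * + 2) * (1ℤ + q * + 2) + 1ℤ
  odd-square = solve-∀
  4∣1 : 4 ℕ.∣ 1
  4∣1 = subst (+ 4 ∣_) (trans (odd-square σ q) (cong (_+ 1ℤ) (ℤ.i≡j⇒i-j≡0 eq)))
    (∣⇒∣ᵤ (Signed.∣m⇒∣m*n (σ - q * q - q) (Signed.∣-refl {+ 4})))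
... | suc (suc _) | q | ℕ.s≤s (ℕ.s≤s ()) | _

-- Integrality of σ.

ℤtoℚ-+ : ∀ a b → ℤtoℚ a ℚ.+ ℤtoℚ b ≡ ℤtoℚ (a + b)
ℤtoℚ-+ a b = trans (cong₂ ℚ._+_ (ℤtoℚ≡ι a) (ℤtoℚ≡ι b))
                (cong ℤtoℚ (cong₂ _+_ (ℤ.*-identityʳ a) (ℤ.*-identityʳ b)))

ℤtoℚ-neg : ∀ a → ℚ.- ℤtoℚ a ≡ ℤtoℚ (- a)
ℤtoℚ-neg a = trans (cong ℚ.-_ (ℤtoℚ≡ι a)) (trans (neg a) (sym (ℤtoℚ≡ι (- a))))
  where
  neg : ∀ a → ℚ.- ι a ≡ ι (- a)
  neg (+ zero)    = refl
  neg (+ suc n)   = refl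
  neg ℤ.-[1+ n ]  = refl

exact-quotient : ∀ a c m → a ≡ c * + suc m → a ℚ./ suc m ≡ ℤtoℚ c
exact-quotient a c m eq = ℚ.fromℚᵘ-cong {mkℚᵘ a m} {mkℚᵘ c 0} (*≡* (trans (ℤ.*-identityʳ a) eq))

sigma-integral : ∀ m k₁ l₁ k₂ l₂ (v≥2 : 2 ≤ suc m) c → + 2 * + k₁ * + k₂ ≡ c * (+ suc m - 1ℤ) →
                 sigma (suc m) k₁ l₁ k₂ l₂ v≥2 ≡ ℤtoℚ ((+ k₁ - + l₁) * (+ k₂ - + l₂) - c + 1ℤ)
sigma-integral (suc m) k₁ l₁ k₂ l₂ (ℕ.s≤s (ℕ.s≤s ℕ.z≤n)) c eq = begin
  ℤtoℚ n ℚ.- (+ (2 ℕ.* k₁ ℕ.* k₂)) ℚ./ suc m ℚ.+ ℚ.1ℚ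
    ≡⟨ cong (λ t → ℤtoℚ n ℚ.- t ℚ.+ ℚ.1ℚ) (exact-quotient (+ (2 ℕ.* k₁ ℕ.* k₂)) c m
         (trans (ℤ.pos-* (2 ℕ.* k₁) k₂) (trans (cong (_* + k₂) (ℤ.pos-* 2 k₁)) eq))) ⟩
  ℤtoℚ n ℚ.- ℤtoℚ c ℚ.+ ℤtoℚ 1ℤ
    ≡⟨ cong (ℚ._+ ℤtoℚ 1ℤ) (trans (cong (ℤtoℚ n ℚ.+_) (ℤtoℚ-neg c)) (ℤtoℚ-+ n (- c))) ⟩
  ℤtoℚ (n - c) ℚ.+ ℤtoℚ 1ℤ ≡⟨ ℤtoℚ-+ (n - c) 1ℤ ⟩
  ℤtoℚ (n - c + 1ℤ) ∎
  where
  open ≡-Reasoning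
  n = (+ k₁ - + l₁) * (+ k₂ - + l₂)

-- Rational solutions of the norm equation.

global-e≡0 : ∀ σ b d → + 4 * σ ≡ d * d → GlobalSolution σ b
global-e≡0 σ b d 4σ≡dd = record
  { x = + 2 ; y = 0ℤ ; z = d
  ; nontrivial = inj₁ λ ()
  ; equation = trans (expand-2 σ b) 4σ≡dd
  }
  where
  expand-2 : ∀ σ b → σ * (+ 2 * + 2) + b * (0ℤ * 0ℤ) ≡ + 4 * σ
  expand-2 = solve-∀

global-square : ∀ σ b t s → s ≢ 0ℤ → b * (t * t) ≡ s * s → GlobalSolution σ b
global-square σ b t s s≢0 eq = record
  { x = 0ℤ ; y = t ; z = s
  ; nontrivial = inj₂ (inj₂ s≢0)
  ; equation = trans (drop-σ σ b t) eq
  }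
  where
  drop-σ : ∀ σ b t → σ * (0ℤ * 0ℤ) + b * (t * t) ≡ b * (t * t)
  drop-σ = solve-∀

-- The identity 4σ - e = d² represents a square by σ and -e. From v e t² = s² one has e = v(e t /
-- s)²; substituting this and clearing `s` gives the witness.
global-neg : ∀ σ v e d t s → + 4 * σ ≡ e + d * d → s ≢ 0ℤ → v * e * (t * t) ≡ s * s → GlobalSolution σ (- v)
global-neg σ v e d t s 4σ s≢0 eq = record
  { x = + 2 * s ; y = e * t ; z = d * s
  ; nontrivial = inj₁ (≢0-* {+ 2} (λ ()) s≢0)
  ; equation = begin
      σ * (+ 2 * s * (+ 2 * s)) + - v * (e * t * (e * t)) ≡⟨ regroup σ v e t s ⟩
      + 4 * σ * (s * s) - e * (v * e * (t * t))           ≡⟨ cong₂ (λ x y → x * (s * s) - e * y) 4σ eq ⟩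
      (e + d * d) * (s * s) - e * (s * s)                 ≡⟨ cancel e d s ⟩
      d * s * (d * s)                                     ∎
  }
  where
  open ≡-Reasoning
  regroup : ∀ σ v e t s → σ * (+ 2 * s * (+ 2 * s)) + - v * (e * t * (e * t)) ≡ + 4 * σ * (s * s) - e * (v * e * (t * t))
  regroup = solve-∀
  cancel : ∀ e d s → (e + d * d) * (s * s) - e * (s * s) ≡ d * s * (d * s)
  cancel = solve-∀

square-class-even : ∀ v e k {h} → h ≡ k ℕ.* 2 → 1ℤ ~ v * e ^ h → ∃ λ t → ∃ λ s → s ≢ 0ℤ × v * (t * t) ≡ s * s
square-class-even v e k refl (mk~ {s} {t} s≢0 _ eq) = e ^ k * t , s , s≢0 , (begin
  v * (e ^ k * t * (e ^ k * t))   ≡⟨ regroup v (e ^ k) t ⟩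
  v * (e ^ k * e ^ k) * (t * t)   ≡⟨ cong (λ x → v * x * (t * t)) (^-double e k) ⟨
  v * e ^ (k ℕ.* 2) * (t * t)     ≡⟨ eq ⟨
  1ℤ * (s * s)                    ≡⟨ ℤ.*-identityˡ (s * s) ⟩
  s * s                           ∎)
  where
  open ≡-Reasoning
  regroup : ∀ v f t → v * (f * t * (f * t)) ≡ v * (f * f) * (t * t)
  regroup = solve-∀

square-class-odd : ∀ v e k {h} → h ≡ suc (k ℕ.* 2) → 1ℤ ~ v * e ^ h → ∃ λ t → ∃ λ s → s ≢ 0ℤ × v * e * (t * t) ≡ s * s
square-class-odd v e k refl (mk~ {s} {t} s≢0 t≢0 eq) =
  square-class-even (v * e) e k refl (mk~ s≢0 t≢0 (trans eq (cong (_* (t * t)) (sym (ℤ.*-assoc v e (e ^ (k ℕ.* 2)))))))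

-- From solutions to symbol values.

HilbertSymbol-involution : ∀ {p a b s} → HilbertSymbol p a b s → s * s ≡ 1ℤ
HilbertSymbol-involution (inj₁ (refl , _)) = refl
HilbertSymbol-involution (inj₂ (refl , _)) = refl

HilbertSymbol-solvable : ∀ {p a b s} → HilbertSymbol p (ℤtoℚ a) (ℤtoℚ b) s → Solvable p a b → s ≡ 1ℤ
HilbertSymbol-solvable (inj₁ (s≡1 , _)) _ = s≡1
HilbertSymbol-solvable {a = a} {b} (inj₂ (_ , ¬solvable)) sol = contradiction (fromSolvable a b sol) ¬solvable

HilbertSymbol-product : ∀ {p a b b′ s s′} → HilbertSymbol p (ℤtoℚ a) (ℤtoℚ b) s → HilbertSymbol p (ℤtoℚ a) (ℤtoℚ b′) s′ →
                        (Solvable p a b → ¬ ¬ Solvable p a b′) → (Solvable p a b′ → ¬ ¬ Solvable p a b) → s * s′ ≡ 1ℤ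
HilbertSymbol-product (inj₁ (refl , _)) (inj₁ (refl , _)) _ _ = refl
HilbertSymbol-product (inj₂ (refl , _)) (inj₂ (refl , _)) _ _ = refl
HilbertSymbol-product {a = a} {b} {b′} (inj₁ (_ , sol)) (inj₂ (_ , ¬sol)) f _ =
  contradiction (λ sol′ → ¬sol (fromSolvable a b′ sol′)) (f (toSolvable a b sol))
HilbertSymbol-product {a = a} {b} {b′} (inj₂ (_ , ¬sol)) (inj₁ (_ , sol)) _ g =
  contradiction (λ sol′ → ¬sol (fromSolvable a b sol′)) (g (toSolvable a b′ sol))

-1^-even : ∀ k v {h} → h ≡ k ℕ.* 2 → -1ℤ ^ h * v ≡ v
-1^-even k v refl = trans (cong (_* v) (involution-^-double -1ℤ refl k)) (ℤ.*-identityˡ v)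

-1^-odd : ∀ k v {h} → h ≡ suc (k ℕ.* 2) → -1ℤ ^ h * v ≡ - v
-1^-odd k v refl = trans (cong (λ t → -1ℤ * t * v) (involution-^-double -1ℤ refl k)) (ℤ.-1*i≡-i v)

module OddOrder {σ v h} (σ≢0 : σ ≢ 0ℤ) (G : GlobalSolution σ (-1ℤ ^ h * v))
                {p} (p-prime : Prime p) {s₁ s₂ s₃}
                (H₁ : HilbertSymbol p (ℤtoℚ σ) (ℤtoℚ σ) s₁)
                (H₂ : HilbertSymbol p (ℤtoℚ σ) (ℤtoℚ v) s₂)
                (H₃ : HilbertSymbol p (ℤtoℚ σ) (ℤtoℚ (-1ℤ ^ h * v)) s₃) (v≢0 : v ≢ 0ℤ) where

  s₁s₁≡1 : s₁ * s₁ ≡ 1ℤ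
  s₁s₁≡1 = HilbertSymbol-involution {p} {ℤtoℚ σ} {ℤtoℚ σ} H₁

  s₃≡1 : s₃ ≡ 1ℤ
  s₃≡1 = HilbertSymbol-solvable {a = σ} { -1ℤ ^ h * v} H₃ (global⇒local p-prime G)

  -- For even `h` the rational solution belongs to (σ, v), so both factors are 1. For odd `h` it
  -- belongs to (σ, -v); as -σ is always a norm, σ and v are norms together, so `s₁` and `s₂` agree.
  s₁^h*s₂≡1 : ∃ (λ k → h ≡ k ℕ.* 2 ⊎ h ≡ suc (k ℕ.* 2)) → s₁ ^ h * s₂ ≡ 1ℤ
  s₁^h*s₂≡1 (k , inj₁ h≡) = cong₂ _*_
    (trans (cong (s₁ ^_) h≡) (involution-^-double s₁ s₁s₁≡1 k))
    (HilbertSymbol-solvable {a = σ} {v} H₂ (subst (Solvable p σ) (-1^-even k v h≡) (global⇒local p-prime G)))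
  s₁^h*s₂≡1 (k , inj₂ h≡) = trans
    (cong (_* s₂) (trans (cong (s₁ ^_) h≡)
      (trans (cong (s₁ *_) (involution-^-double s₁ s₁s₁≡1 k)) (ℤ.*-identityʳ s₁))))
    (HilbertSymbol-product {a = σ} {σ} {v} H₁ H₂ (transfer σ≢0 refl) (transfer v≢0 (ℤ.*-comm v σ)))
    where open NormTransfer p-prime {σ} {v} (subst (GlobalSolution σ) (-1^-odd k v h≡) G)

  product-formula : s₁ ^ ((h ℕ.* 2) C 2) * s₂ ≡ s₃ × s₃ ≡ 1ℤ
  product-formula =
    trans (cong (_* s₂) (involution-^-choose s₁ s₁s₁≡1 h))
          (trans (s₁^h*s₂≡1 (parity h)) (sym s₃≡1)) , s₃≡1

-- If e = 0, σ is the square of d/2 and any second argument will do. Otherwise v is a square up to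
-- squares of integers when `h` is even, while for odd `h` it lies in the class of e and 4σ - e = d²
-- applies.
global-solution : ∀ {σ v e d} h → + 4 * σ ≡ e + d * d → (e ≢ 0ℤ → 1ℤ ~ v * e ^ h) → GlobalSolution σ (-1ℤ ^ h * v)
global-solution {σ} {v} {e} {d} h 4σ class = go (e ℤ.≟ 0ℤ) (parity h)
  where
  go : _ → ∃ (λ k → h ≡ k ℕ.* 2 ⊎ h ≡ suc (k ℕ.* 2)) → GlobalSolution σ (-1ℤ ^ h * v)
  go (yes e≡0) _ = global-e≡0 σ (-1ℤ ^ h * v) d
    (trans 4σ (trans (cong (_+ d * d) e≡0) (ℤ.+-identityˡ (d * d))))
  go (no e≢0) (k , inj₁ h≡) = let t , s , s≢0 , eq = square-class-even v e k h≡ (class e≢0) in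
    subst (GlobalSolution σ) (sym (-1^-even k v h≡)) (global-square σ v t s s≢0 eq)
  go (no e≢0) (k , inj₂ h≡) = let t , s , s≢0 , eq = square-class-odd v e k h≡ (class e≢0) in
    subst (GlobalSolution σ) (sym (-1^-odd k v h≡)) (global-neg σ v e d t s 4σ s≢0 eq)

-- The rational `q` is kept as a variable so that matching its equation with `refl` puts the integer
-- σ in place of the fraction in all three symbols.
odd-order : ∀ {m σ e d} → + 4 * σ ≡ e + d * d → (e ≢ 0ℤ → ∃ λ h → m ≡ 2 ℕ.* h × 1ℤ ~ + suc m * e ^ h) →
            suc m % 2 ≡ 1 → ∀ {q} → q ≡ ℤtoℚ σ → q ≢ 0ℚ → ∀ {p} → Prime p → ∀ {s₁ s₂ s₃} →
            HilbertSymbol p q q s₁ → HilbertSymbol p q (ℤtoℚ (+ suc m)) s₂ →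
            HilbertSymbol p q (ℤtoℚ (-1ℤ ^ (m / 2) * + suc m)) s₃ → s₁ ^ (m C 2) * s₂ ≡ s₃ × s₃ ≡ + 1
odd-order {m} {σ} {e} {d} 4σ class v-odd refl q≢0 {p} p-prime {s₁} {s₂} {s₃} H₁ H₂ H₃ =
  subst (λ n → s₁ ^ (n C 2) * s₂ ≡ s₃ × s₃ ≡ + 1) (sym m≡h*2)
    (OddOrder.product-formula {σ} {+ suc m} {h} (q≢0 ∘ cong ℤtoℚ) (global-solution {d = d} h 4σ class-h) p-prime H₁ H₂
      (subst (λ i → HilbertSymbol p (ℤtoℚ σ) (ℤtoℚ (-1ℤ ^ i * + suc m)) s₃) m/2≡h H₃) (λ ()))
  where
  h = proj₁ (odd-pred m v-odd)
  m≡h*2 : m ≡ h ℕ.* 2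
  m≡h*2 = proj₂ (odd-pred m v-odd)
  m/2≡h : m / 2 ≡ h
  m/2≡h = trans (cong (_/ 2) m≡h*2) (ℕ.m*n/n≡m h 2)
  class-h : e ≢ 0ℤ → 1ℤ ~ + suc m * e ^ h
  class-h e≢0 = let h′ , m≡2*h′ , g = class e≢0 in
    subst (λ i → 1ℤ ~ + suc m * e ^ i)
      (ℕ.*-cancelʳ-≡ h′ h 2 (trans (ℕ.*-comm h′ 2) (trans (sym m≡2*h′) m≡h*2))) g

even-order : ∀ {m σ e d} → + 4 * σ ≡ e + d * d → (e ≢ 0ℤ → ∃ λ h → m ≡ 2 ℕ.* h × 1ℤ ~ + suc m * e ^ h) →
             suc m % 2 ≡ 0 → ∃ λ z → σ ≡ z * z
even-order {m} {σ} {e} {d} 4σ class v-even =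
  half-square σ d (trans 4σ (trans (cong (_+ d * d) e≡0) (ℤ.+-identityˡ (d * d))))
  where
  e≡0 : e ≡ 0ℤ
  e≡0 = decidable-stable (e ℤ.≟ 0ℤ) λ e≢0 → let h , m≡2*h , _ = class e≢0 in
    ℕ.0≢1+n (trans (sym v-even) (trans (cong (λ n → suc n % 2) m≡2*h) (even-suc h)))

theorem4p10 : (v k l k₁ l₁ k₂ l₂ : ℕ) (v≥2 : 2 ≤ v) (M M₁ M₂ : Matrix v) →
    IsSymmetricDesign v k l M →
    IsSymmetricDesign v k₁ l₁ M₁ →
    IsSymmetricDesign v k₂ l₂ M₂ →
    (∀ i j → M i j ≡ M₁ i j + M₂ i j) →
    (v % 2 ≡ 0 → ∃ λ (z : ℤ) → sigma v k₁ l₁ k₂ l₂ v≥2 ≡ ℤtoℚ (z * z))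
    ×
    (v % 2 ≡ 1 → sigma v k₁ l₁ k₂ l₂ v≥2 ≢ 0ℚ →
    ∀ p → Prime p → p ≢ 2 →
    ∀ s₁ s₂ s₃ →
    HilbertSymbol p (sigma v k₁ l₁ k₂ l₂ v≥2) (sigma v k₁ l₁ k₂ l₂ v≥2) s₁ →
    HilbertSymbol p (sigma v k₁ l₁ k₂ l₂ v≥2) (ℤtoℚ (+ v)) s₂ →
    HilbertSymbol p (sigma v k₁ l₁ k₂ l₂ v≥2) (ℤtoℚ ((-1ℤ ^ ((v ∸ 1) / 2)) * + v)) s₃ →
    ((s₁ ^ ((v ∸ 1) C 2)) * s₂ ≡ s₃) × (s₃ ≡ + 1))
theorem4p10 zero _ _ _ _ _ _ ()
theorem4p10 (suc m) k l k₁ l₁ k₂ l₂ v≥2 M M₁ M₂ D D₁ D₂ M≡M₁+M₂ =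
    (λ v-even → let z , σ≡zz = even-order {d = c - + 2} 4σ class v-even in z , trans sigma≡σ (cong ℤtoℚ σ≡zz))
  , (λ v-odd σ≢0 p p-prime _ s₁ s₂ s₃ H₁ H₂ H₃ →
      odd-order {d = c - + 2} 4σ class v-odd sigma≡σ σ≢0 p-prime H₁ H₂ H₃)
  where
  -- The index `zero` supplies a row for k = k₁ + k₂ and shows that v ≠ 0.
  open Decomposition D D₁ D₂ M≡M₁+M₂ zero
  sigma≡σ : sigma (suc m) k₁ l₁ k₂ l₂ v≥2 ≡ ℤtoℚ σ
  sigma≡σ = sigma-integral m k₁ l₁ k₂ l₂ v≥2 c 2k₁k₂
  class : e ≢ 0ℤ → ∃ λ h → m ≡ 2 ℕ.* h × 1ℤ ~ + suc m * e ^ h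
  class = square-class S-similitude
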